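{- Let $q$ be a prime power, $n$ a positive integer, and let $\alpha\in\mathbb{F}_{q^{2n}}$ be such that $\mathbb{F}_{q^{2n}}=\mathbb{F}_q(\alpha)$. Then the number $S(\alpha,2,n;q)$ of $2$-dimensional $\alpha$-splitting subspaces of $\mathbb{F}_{q^{2n}}$ is $$S(\alpha,2,n;q)=\frac{q^{2n}-1}{q^2-1}\,q^{2(n-1)}.$$
   Context: $\mathbb{F}_q$ denotes the finite field with $q$ elements. For positive integers $m,n$ and $\alpha\in\mathbb{F}_{q^{mn}}$, an $m$-dimensional $\mathbb{F}_q$-linear subspace $W$ of $\mathbb{F}_{q^{mn}}$ is called $\alpha$-splitting if $\mathbb{F}_{q^{mn}}=W\oplus \alpha W\oplus\cdots\oplus\alpha^{n-1}W$ (internal direct sum of $\mathbb{F}_q$-subspaces). $S(\alpha,m,n;q)$ denotes the number of $m$-dimensional $\alpha$-splitting subspaces of $\mathbb{F}_{q^{mn}}$. -}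

module Defs where

open import Level using (0ℓ)
open import Algebra.Bundles using (CommutativeRing)
open import Data.Nat using (ℕ; zero; suc; _^_)
open import Data.Nat.Primality using (Prime)
open import Data.Fin using (Fin; toℕ)
import Data.Fin
open import Data.Product using (Σ; ∃; _×_; _,_)
open import Relation.Nullary using (¬_)
open import Relation.Unary using (Pred)
open import Relation.Binary.PropositionalEquality using (_≡_)

IsPrimePower : ℕ → Set
IsPrimePower q = Σ ℕ λ p → Σ ℕ λ k → Prime p × q ≡ p ^ suc k

CountedBy : ∀ {a p r} {A : Set a} → (P : A → Set p) → (_~_ : A → A → Set r) → ℕ → Set _
CountedBy {A = A} P _~_ N =
  Σ (Fin N → A) λ f →
    (∀ i → P (f i)) ×
    (∀ i j → f i ~ f j → i ≡ j) ×
    (∀ x → P x → ∃ λ i → f i ~ x)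

module FieldTheory (R : CommutativeRing 0ℓ 0ℓ) where
  open CommutativeRing R

  IsField : Set
  IsField = (¬ (1# ≈ 0#)) × (∀ x → ¬ (x ≈ 0#) → ∃ λ y → x * y ≈ 1#)

  IsSubfield : Pred Carrier 0ℓ → Set
  IsSubfield K =
    (∀ {x y} → x ≈ y → K x → K y) ×
    K 0# × K 1# ×
    (∀ {x y} → K x → K y → K (x + y)) ×
    (∀ {x} → K x → K (- x)) ×
    (∀ {x y} → K x → K y → K (x * y)) ×
    (∀ {x y} → K x → ¬ (x ≈ 0#) → x * y ≈ 1# → K y)

  Generates : Pred Carrier 0ℓ → Carrier → Set₁
  Generates K α =
    (M : Pred Carrier 0ℓ) → IsSubfield M → (∀ {x} → K x → M x) → M α → ∀ x → M x

  IsSubspace : Pred Carrier 0ℓ → Pred Carrier 0ℓ → Set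
  IsSubspace K W =
    (∀ {x y} → x ≈ y → W x → W y) ×
    W 0# ×
    (∀ {x y} → W x → W y → W (x + y)) ×
    (∀ {c x} → K c → W x → W (c * x))

  HasDim2 : Pred Carrier 0ℓ → Pred Carrier 0ℓ → Set
  HasDim2 K W = Σ Carrier λ w₁ → Σ Carrier λ w₂ →
    W w₁ × W w₂ ×
    (∀ {a b} → K a → K b → a * w₁ + b * w₂ ≈ 0# → (a ≈ 0#) × (b ≈ 0#)) ×
    (∀ {x} → W x → Σ Carrier λ a → Σ Carrier λ b → K a × K b × x ≈ a * w₁ + b * w₂)

  pow : Carrier → ℕ → Carrier
  pow x zero = 1#
  pow x (suc k) = x * pow x k

  sumFin : (n : ℕ) → (Fin n → Carrier) → Carrier
  sumFin zero f = 0#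
  sumFin (suc n) f = f Data.Fin.zero + sumFin n (λ i → f (Data.Fin.suc i))

  IsSplitting : Carrier → ℕ → Pred Carrier 0ℓ → Set
  IsSplitting α n W =
    (∀ x → Σ (Fin n → Carrier) λ w → (∀ i → W (w i)) ×
            x ≈ sumFin n (λ i → pow α (toℕ i) * w i)) ×
    (∀ (w w′ : Fin n → Carrier) → (∀ i → W (w i)) → (∀ i → W (w′ i)) →
       sumFin n (λ i → pow α (toℕ i) * w i) ≈ sumFin n (λ i → pow α (toℕ i) * w′ i) →
       ∀ i → w i ≈ w′ i)

  Is2DimSplitting : Pred Carrier 0ℓ → Carrier → ℕ → Pred Carrier 0ℓ → Set
  Is2DimSplitting K α n W = IsSubspace K W × HasDim2 K W × IsSplitting α n W

  -- Subspaces are identified when they have the same elements.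
  SameSet : Pred Carrier 0ℓ → Pred Carrier 0ℓ → Set
  SameSet W V = (∀ {x} → W x → V x) × (∀ {x} → V x → W x)

{-# OPTIONS --safe #-}
-- Put N = q²ⁿ and let V k be the K-span of 1, α, …, αᵏ⁻¹. A plane spanned by w₁, w₂ is
-- α-splitting iff f w₁ + g w₂ = 0 with f, g ∈ V n forces f = g = 0, i.e. iff w₁ ≠ 0 and
-- β = w₂ / w₁ is good: U n β = { g ∈ V n : g β ∈ V n } is zero.
--
-- Since α has degree 2n over K, comparing the coefficients of degree 2n - 2 in
-- g (g₀ β) = g₀ (g β) shows that U (n - 1) β has codimension one in U n β whenever U n β ≠ 0.
-- Hence #(U n β) + (q - 1) [β good] = q #(U (n - 1) β). Summing over β, where
-- Σ_β #(U k β) = N + (qᵏ - 1) qᵏ by double counting, gives (q - 1) q²ⁿ⁻¹ good β.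
-- So there are (N - 1) (q - 1) q²ⁿ⁻¹ good pairs (w₁ , w₂), and every splitting plane has
-- (q² - 1) (q² - q) of them as bases.
module Submission where

open import Defs
open import Level using (Level; 0ℓ)
open import Algebra.Bundles using (CommutativeRing)
open import Algebra.Solver.Ring.AlmostCommutativeRing using (fromCommutativeRing; _-Raw-AlmostCommutative⟶_)
import Algebra.Solver.Ring
open import Data.Maybe using (Maybe; just; nothing)
open import Data.Nat as ℕ using (ℕ; zero; suc)
import Data.Nat.Properties as ℕ
open import Data.Sign as Sign using (Sign)
open import Relation.Nullary using (Dec; yes; no; ¬_; contradiction)
import Relation.Binary.PropositionalEquality as ≡

-- Cardinality replaces dimension throughout: adjoining a vector outside a subspace multiplies its
-- size by `q`, and an inclusion of equal sizes is an equality. Likewise a direct sum that is large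
-- enough is everything, and for this reason directness alone makes a plane splitting: `V n` × `V n`
-- has exactly `N` elements. The coefficient comparison is sound because 2n - 2 is below the degree
-- of α, so no reduction interferes. It makes the pairs of leading coefficients of (g, g β)
-- proportional, which bounds the codimension by one. It is not zero, because multiplication by α
-- pushes any nonzero element up to the top degree. For good β both spaces have size 1, and q - 1 is
-- what 1 lacks to q. With x = qⁿ⁻¹ and N = q² x², the sum over β leaves q (N + x² - x) - (N + q² x²
-- - q x) = (q - 1)² q x². A plane in the statement is an arbitrary predicate, so planes cannot be
-- listed directly. The finitely many good pairs are listed instead, one is chosen for each span,
-- and `S` is the number of choices.

module IntegerCoefficients (R : CommutativeRing 0ℓ 0ℓ) where
  open import Data.Integer as ℤ using (ℤ; +_; -[1+_]; _⊖_; _◃_)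
  import Data.Integer.Properties as ℤ
  open CommutativeRing R
  open import Algebra.Properties.Ring ring using (-0#≈0#; -‿distribˡ-*; -‿distribʳ-*; -‿involutive)
  open import Algebra.Properties.AbelianGroup +-abelianGroup using (⁻¹-∙-comm)
  open import Algebra.Properties.Semiring.Mult.TCOptimised semiring using (1+×; ×-homo-+; ×1-homo-*) renaming (_×_ to _×′_)
  open import Algebra.Properties.CommutativeSemigroup +-commutativeSemigroup using (interchange)
  open import Relation.Binary.Reasoning.Setoid setoid

  -- The ring solver has to recognise cancellations such as `x - x`. It therefore computes with
  -- coefficients in ℤ, where equality is decidable, and transports the result along this
  -- homomorphism.
  ι : ℤ → Carrier
  ι (+ n) = n ×′ 1#
  ι -[1+ n ] = - (suc n ×′ 1#)

  ι-⊖ : ∀ m n → ι (m ⊖ n) ≈ m ×′ 1# - n ×′ 1#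
  ι-⊖ zero zero = sym (-‿inverseʳ 0#)
  ι-⊖ zero (suc n) = sym (+-identityˡ _)
  ι-⊖ (suc m) zero = sym (trans (+-congˡ -0#≈0#) (+-identityʳ _))
  ι-⊖ (suc m) (suc n) = begin
    ι (suc m ⊖ suc n)                          ≡⟨ ≡.cong ι (ℤ.[1+m]⊖[1+n]≡m⊖n m n) ⟩
    ι (m ⊖ n)                                  ≈⟨ ι-⊖ m n ⟩
    m ×′ 1# - n ×′ 1#                          ≈⟨ +-identityˡ _ ⟨
    0# + (m ×′ 1# - n ×′ 1#)                   ≈⟨ +-congʳ (-‿inverseʳ 1#) ⟨
    (1# - 1#) + (m ×′ 1# - n ×′ 1#)            ≈⟨ interchange 1# (- 1#) _ _ ⟩
    (1# + m ×′ 1#) + (- 1# - n ×′ 1#)          ≈⟨ +-cong (sym (1+× m 1#)) (⁻¹-∙-comm 1# _) ⟩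
    suc m ×′ 1# - (1# + n ×′ 1#)               ≈⟨ +-congˡ (-‿cong (1+× n 1#)) ⟨
    suc m ×′ 1# - suc n ×′ 1#                  ∎

  ι-+ : ∀ i j → ι (i ℤ.+ j) ≈ ι i + ι j
  ι-+ (+ m) (+ n) = ×-homo-+ 1# m n
  ι-+ (+ m) -[1+ n ] = ι-⊖ m (suc n)
  ι-+ -[1+ m ] (+ n) = trans (ι-⊖ n (suc m)) (+-comm _ _)
  ι-+ -[1+ m ] -[1+ n ] = begin
    - (suc (suc (m ℕ.+ n)) ×′ 1#)     ≡⟨ ≡.cong (λ k → - (suc k ×′ 1#)) (≡.sym (ℕ.+-suc m n)) ⟩
    - ((suc m ℕ.+ suc n) ×′ 1#)       ≈⟨ -‿cong (×-homo-+ 1# (suc m) (suc n)) ⟩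
    - (suc m ×′ 1# + suc n ×′ 1#)     ≈⟨ ⁻¹-∙-comm _ _ ⟨
    - (suc m ×′ 1#) - suc n ×′ 1#     ∎

  ι-neg◃ : ∀ n → ι (Sign.- ◃ n) ≈ - (n ×′ 1#)
  ι-neg◃ zero = sym -0#≈0#
  ι-neg◃ (suc n) = refl

  ι-* : ∀ i j → ι (i ℤ.* j) ≈ ι i * ι j
  ι-* (+ m) (+ n) = trans (reflexive (≡.cong ι (ℤ.+◃n≡+n (m ℕ.* n)))) (×1-homo-* m n)
  ι-* (+ m) -[1+ n ] = begin
    ι (Sign.- ◃ m ℕ.* suc n)      ≈⟨ ι-neg◃ (m ℕ.* suc n) ⟩
    - ((m ℕ.* suc n) ×′ 1#)       ≈⟨ -‿cong (×1-homo-* m (suc n)) ⟩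
    - (m ×′ 1# * suc n ×′ 1#)     ≈⟨ -‿distribʳ-* _ _ ⟩
    m ×′ 1# * - (suc n ×′ 1#)     ∎
  ι-* -[1+ m ] (+ n) = begin
    ι (Sign.- ◃ suc m ℕ.* n)      ≈⟨ ι-neg◃ (suc m ℕ.* n) ⟩
    - ((suc m ℕ.* n) ×′ 1#)       ≈⟨ -‿cong (×1-homo-* (suc m) n) ⟩
    - (suc m ×′ 1# * n ×′ 1#)     ≈⟨ -‿distribˡ-* _ _ ⟩
    - (suc m ×′ 1#) * n ×′ 1#     ∎
  ι-* -[1+ m ] -[1+ n ] = begin
    (suc m ℕ.* suc n) ×′ 1#               ≈⟨ ×1-homo-* (suc m) (suc n) ⟩
    suc m ×′ 1# * suc n ×′ 1#             ≈⟨ -‿involutive _ ⟨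
    - - (suc m ×′ 1# * suc n ×′ 1#)       ≈⟨ -‿cong (-‿distribˡ-* _ _) ⟩
    - (- (suc m ×′ 1#) * suc n ×′ 1#)     ≈⟨ -‿distribʳ-* _ _ ⟩
    - (suc m ×′ 1#) * - (suc n ×′ 1#)     ∎

  ι-neg : ∀ i → ι (ℤ.- i) ≈ - ι i
  ι-neg (+ zero) = sym -0#≈0#
  ι-neg (+ suc n) = refl
  ι-neg -[1+ n ] = sym (-‿involutive _)

  morphism : ℤ.+-*-rawRing -Raw-AlmostCommutative⟶ fromCommutativeRing R
  morphism = record
    { ⟦_⟧ = ι ; +-homo = ι-+ ; *-homo = ι-* ; -‿homo = ι-neg ; 0-homo = refl ; 1-homo = refl }

  -- `nothing` asserts no inequality: in positive characteristic distinct integers can have the same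
  -- image.
  ι-≟ : ∀ i j → Maybe (ι i ≈ ι j)
  ι-≟ i j with i ℤ.≟ j
  ... | yes eq = just (reflexive (≡.cong ι eq))
  ... | no _ = nothing

  open Algebra.Solver.Ring ℤ.+-*-rawRing (fromCommutativeRing R) morphism ι-≟ public
    using (Polynomial; solve; _:=_; _:+_; _:*_; _:-_; :-_; con)

  :0 :1 : ∀ {n} → Polynomial n
  :0 = con (+ 0)
  :1 = con (+ 1)

open import Algebra.Properties.Semiring.Sum ℕ.+-*-semiring using (sum; sum-cong-≗; ∑-distrib-+; ∑-comm; sum-permute; *-distribˡ-sum; *-distribʳ-sum)
open import Data.Fin using (Fin; zero; suc; toℕ; combine; remQuot; _↑ˡ_; _↑ʳ_)
open import Data.Fin.Permutation using (permutation)
open import Data.Fin.Properties using (any?; all?; suc-injective; pigeonhole; remQuot-combine) renaming (_≟_ to _≟ᶠ_)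
open import Data.Nat using (_+_; _*_; _∸_; _^_; _≤_; _<_; z≤n; s≤s; _≤′_; ≤′-reflexive; ≤′-step)
open import Data.Nat.Primality using (prime⇒nonTrivial)
open import Data.Nat.Tactic.RingSolver using (solve-∀)
open import Data.Product using (Σ; ∃; _×_; _,_; proj₁; proj₂)
open import Data.Unit using (⊤; tt)
open import Relation.Nullary.Decidable using (_×-dec_; _→-dec_; ¬?; map′)
open import Relation.Unary using (Pred)
open ≡ using (_≡_; module ≡-Reasoning)

-- Sums of indicators over finite index sets

private variable
  p r : Level
  P Q : Set p
  m l : ℕ

[_] : Dec P → ℕ
[ yes _ ] = 1
[ no _ ] = 0

[]-yes : (d : Dec P) → P → [ d ] ≡ 1
[]-yes (yes _) _ = ≡.refl
[]-yes (no ¬p) x = contradiction x ¬p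

[]-no : (d : Dec P) → ¬ P → [ d ] ≡ 0
[]-no (yes x) ¬p = contradiction x ¬p
[]-no (no _) _ = ≡.refl

[]-cong : (d : Dec P) (e : Dec Q) → (P → Q) → (Q → P) → [ d ] ≡ [ e ]
[]-cong (yes x) e f g = ≡.sym ([]-yes e (f x))
[]-cong (no ¬p) e f g = ≡.sym ([]-no e (λ y → ¬p (g y)))

[]-mono : (d : Dec P) (e : Dec Q) → (P → Q) → [ d ] ≤ [ e ]
[]-mono (yes x) e f = ℕ.≤-reflexive (≡.sym ([]-yes e (f x)))
[]-mono (no _) e f = z≤n

[]-× : (d : Dec P) (e : Dec Q) → [ d ×-dec e ] ≡ [ d ] * [ e ]
[]-× (yes x) (yes y) = ≡.refl
[]-× (yes x) (no ¬y) = ≡.refl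
[]-× (no ¬x) e = ≡.refl

[]-witness : (d : Dec P) → [ d ] ≡ 1 → P
[]-witness (yes x) _ = x

sum-const : ∀ l c → sum {l} (λ _ → c) ≡ l * c
sum-const zero c = ≡.refl
sum-const (suc l) c = ≡.cong (c +_) (sum-const l c)

sum-zero : (f : Fin l → ℕ) → (∀ i → f i ≡ 0) → sum f ≡ 0
sum-zero {l} f f≡0 = ≡.trans (sum-cong-≗ f≡0) (≡.trans (sum-const l 0) (ℕ.*-zeroʳ l))

sum-single : (f : Fin l → ℕ) (i : Fin l) → (∀ j → ¬ (j ≡ i) → f j ≡ 0) → sum f ≡ f i
sum-single f zero h = ≡.trans (≡.cong (f zero +_) (sum-zero (λ j → f (suc j)) (λ j → h (suc j) λ ()))) (ℕ.+-identityʳ _)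
sum-single f (suc i) h = ≡.cong₂ _+_ (h zero λ ()) (sum-single (λ j → f (suc j)) i (λ j j≢i → h (suc j) (λ e → j≢i (suc-injective e))))

module _ {P : Fin l → Set p} (P? : ∀ i → Dec (P i)) where

  sum-unique : ∀ i → P i → (∀ j → P j → j ≡ i) → sum (λ j → [ P? j ]) ≡ 1
  sum-unique i Pi uniq =
    ≡.trans (sum-single _ i (λ j j≢i → []-no (P? j) (λ Pj → j≢i (uniq j Pj)))) ([]-yes (P? i) Pi)

  sum-none : (∀ i → ¬ P i) → sum (λ j → [ P? j ]) ≡ 0
  sum-none none = sum-zero _ (λ i → []-no (P? i) (none i))

  sum-≤1 : (∀ i j → P i → P j → i ≡ j) → sum (λ j → [ P? j ]) ≤ 1
  sum-≤1 uniq with any? P?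
  ... | yes (i , Pi) = ℕ.≤-reflexive (sum-unique i Pi (λ j Pj → uniq j i Pj Pi))
  ... | no none = ℕ.≤-trans (ℕ.≤-reflexive (sum-none (λ i Pi → none (i , Pi)))) z≤n

sum-mono-≤ : (f g : Fin l → ℕ) → (∀ i → f i ≤ g i) → sum f ≤ sum g
sum-mono-≤ {zero} f g f≤g = z≤n
sum-mono-≤ {suc l} f g f≤g = ℕ.+-mono-≤ (f≤g zero) (sum-mono-≤ _ _ (λ i → f≤g (suc i)))

-- No term can fall short, since no other term can make up for it. This pigeonhole principle is what
-- later turns an inclusion of equal sizes into an equality, and "at most one representation" into
-- "exactly one".
sum-≤-≡⇒≗ : (f g : Fin l → ℕ) → (∀ i → f i ≤ g i) → sum f ≡ sum g → ∀ i → f i ≡ g i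
sum-≤-≡⇒≗ {suc l} f g f≤g eq = λ where
    zero → head≡
    (suc i) → sum-≤-≡⇒≗ (λ i → f (suc i)) (λ i → g (suc i)) (λ i → f≤g (suc i)) tail≡ i
  where
  tail≤ : sum (λ i → f (suc i)) ≤ sum (λ i → g (suc i))
  tail≤ = sum-mono-≤ _ _ (λ i → f≤g (suc i))
  head≡ : f zero ≡ g zero
  head≡ = ℕ.≤-antisym (f≤g zero)
    (ℕ.+-cancelʳ-≤ (sum (λ i → g (suc i))) _ _
      (ℕ.≤-trans (ℕ.≤-reflexive (≡.sym eq)) (ℕ.+-monoʳ-≤ (f zero) tail≤)))
  tail≡ : sum (λ i → f (suc i)) ≡ sum (λ i → g (suc i))
  tail≡ = ℕ.+-cancelˡ-≡ (f zero) _ _ (≡.trans eq (≡.cong (_+ sum (λ i → g (suc i))) (≡.sym head≡)))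

-- Greedy choice of class representatives.
representatives : {P : Fin m → Set p} (P? : ∀ i → Dec (P i))
  {_~_ : Fin m → Fin m → Set r} (_~?_ : ∀ i j → Dec (i ~ j)) →
  (∀ {i} → i ~ i) → (∀ {i j} → i ~ j → j ~ i) → ∃ λ S → CountedBy P _~_ S
representatives {zero} P? _~?_ _ _ = 0 , (λ ()) , (λ ()) , (λ ()) , (λ ())
representatives {suc m} P? {_~_} _~?_ ~-refl ~-sym
  with representatives (λ i → P? (suc i)) (λ i j → suc i ~? suc j) ~-refl ~-sym
... | S , f , Pf , f-inj , f-surj with P? zero
... | no ¬P₀ = S , (λ s → suc (f s)) , Pf , f-inj ,
      λ where zero P₀ → contradiction P₀ ¬P₀
              (suc i) Pi → f-surj i Pi
... | yes P₀ with any? (λ s → suc (f s) ~? zero)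
... | yes (s , fs~0) = S , (λ s → suc (f s)) , Pf , f-inj ,
      λ where zero _ → s , fs~0
              (suc i) Pi → f-surj i Pi
... | no f≁0 = suc S ,
      (λ where zero → zero
               (suc s) → suc (f s)) ,
      (λ where zero → P₀
               (suc s) → Pf s) ,
      (λ where zero zero _ → ≡.refl
               zero (suc t) e → contradiction (t , ~-sym e) f≁0
               (suc s) zero e → contradiction (s , e) f≁0
               (suc s) (suc t) e → ≡.cong suc (f-inj s t e)) ,
      λ where zero _ → zero , ~-refl
              (suc i) Pi → let s , e = f-surj i Pi in suc s , e

-- Double counting of the pairs formed by a representative and a member of its class. Transitivity
-- and the pairwise inequivalence of the representatives leave each element exactly one
-- representative.
classes-count : ∀ {S c} {P : Fin m → Set p} (P? : ∀ i → Dec (P i))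
  {_~_ : Fin m → Fin m → Set r} (_~?_ : ∀ i j → Dec (i ~ j)) →
  (∀ {i j} → i ~ j → j ~ i) → (∀ {i j k} → i ~ j → j ~ k → i ~ k) →
  CountedBy P _~_ S →
  (∀ i → P i → sum (λ j → [ P? j ×-dec (i ~? j) ]) ≡ c) →
  S * c ≡ sum (λ j → [ P? j ])
classes-count {S = S} {c} P? {_~_} _~?_ ~-sym ~-trans (f , Pf , f-inj , f-surj) size = ≡.sym (begin
  sum (λ j → [ P? j ])                                           ≡⟨ sum-cong-≗ split ⟩
  sum (λ j → sum (λ s → [ P? j ×-dec (f s ~? j) ]))              ≡⟨ ∑-comm (λ j s → [ P? j ×-dec (f s ~? j) ]) ⟩
  sum (λ s → sum (λ j → [ P? j ×-dec (f s ~? j) ]))              ≡⟨ sum-cong-≗ (λ s → size (f s) (Pf s)) ⟩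
  sum {S} (λ s → c)                                              ≡⟨ sum-const S c ⟩
  S * c                                                          ∎)
  where
  open ≡-Reasoning
  split : ∀ j → [ P? j ] ≡ sum (λ s → [ P? j ×-dec (f s ~? j) ])
  split j with P? j
  ... | no ¬Pj = ≡.sym (sum-none (λ s → no ¬Pj ×-dec (f s ~? j)) (λ s e → ¬Pj (proj₁ e)))
  ... | yes Pj with f-surj j Pj
  ... | s , fs~j = ≡.sym (sum-unique (λ s → yes Pj ×-dec (f s ~? j)) s (Pj , fs~j)
          (λ t e → f-inj t s (~-trans (proj₂ e) (~-sym fs~j))))

sum-++ : ∀ m {n} (f : Fin (m + n) → ℕ) → sum f ≡ sum (λ i → f (i ↑ˡ n)) + sum (λ j → f (m ↑ʳ j))
sum-++ zero f = ≡.refl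
sum-++ (suc m) f = ≡.trans (≡.cong (f zero +_) (sum-++ m (λ i → f (suc i)))) (≡.sym (ℕ.+-assoc (f zero) _ _))

sum-combine : ∀ m n (f : Fin (m * n) → ℕ) → sum f ≡ sum (λ (i : Fin m) → sum (λ (j : Fin n) → f (combine i j)))
sum-combine zero n f = ≡.refl
sum-combine (suc m) n f = ≡.trans (sum-++ n f) (≡.cong (sum (λ j → f (j ↑ˡ (m * n))) +_) (sum-combine m n (λ i → f (n ↑ʳ i))))

sum-remQuot : ∀ m n (f : Fin m × Fin n → ℕ) → sum (λ p → f (remQuot {m} n p)) ≡ sum (λ i → sum (λ j → f (i , j)))
sum-remQuot m n f = ≡.trans (sum-combine m n (λ p → f (remQuot {m} n p)))
  (sum-cong-≗ (λ i → sum-cong-≗ (λ j → ≡.cong f (remQuot-combine i j))))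

-- Counting in a finite field L with subfield K

module FiniteExtension
  (L : CommutativeRing 0ℓ 0ℓ) (L-field : FieldTheory.IsField L)
  (K : Pred (CommutativeRing.Carrier L) 0ℓ) (K-subfield : FieldTheory.IsSubfield L K)
  (q N : ℕ) (K-count : CountedBy K (CommutativeRing._≈_ L) q)
  (L-count : CountedBy (λ (_ : CommutativeRing.Carrier L) → ⊤) (CommutativeRing._≈_ L) N)
  where

  open CommutativeRing L public
    renaming (_+_ to _⊕_; _*_ to _·_; -_ to ⊝_; _-_ to _⊖_)
    hiding (zero)
  open FieldTheory L public
  open IntegerCoefficients L using (solve; _:=_; _:+_; _:*_; _:-_; :-_; :0; :1) public

  1≉0 : ¬ (1# ≈ 0#)
  1≉0 = proj₁ L-field

  e : Fin N → Carrier
  e = proj₁ L-count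

  e-injective : ∀ i j → e i ≈ e j → i ≡ j
  e-injective = proj₁ (proj₂ (proj₂ L-count))

  index : Carrier → Fin N
  index x = proj₁ (proj₂ (proj₂ (proj₂ L-count)) x _)

  e-index : ∀ x → e (index x) ≈ x
  e-index x = proj₂ (proj₂ (proj₂ (proj₂ L-count)) x _)

  infix 4 _≈?_

  abstract
    _≈?_ : ∀ x y → Dec (x ≈ y)
    x ≈? y = map′
      (λ eq → trans (sym (e-index x)) (trans (reflexive (≡.cong e eq)) (e-index y)))
      (λ eq → e-injective _ _ (trans (e-index x) (trans eq (sym (e-index y)))))
      (index x ≟ᶠ index y)

    all-dec : {P : Carrier → Set} → (∀ x → Dec (P x)) → (∀ {x y} → x ≈ y → P x → P y) → Dec (∀ x → P x)
    all-dec P? P-resp = map′ (λ h x → P-resp (e-index x) (h (index x))) (λ h i → h (e i)) (all? (λ i → P? (e i)))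

  -- Made total by sending zero to zero, so that quotients can stand inside sums over all of `L`.
  inv : Carrier → Carrier
  inv x with x ≈? 0#
  ... | yes _ = 0#
  ... | no x≉0 = proj₁ (proj₂ L-field x x≉0)

  inv-inverseʳ : ∀ {x} → ¬ (x ≈ 0#) → x · inv x ≈ 1#
  inv-inverseʳ {x} x≉0 with x ≈? 0#
  ... | yes x≈0 = contradiction x≈0 x≉0
  ... | no x≉0 = proj₂ (proj₂ L-field x x≉0)

  inv-inverseˡ : ∀ {x} → ¬ (x ≈ 0#) → inv x · x ≈ 1#
  inv-inverseˡ x≉0 = trans (*-comm _ _) (inv-inverseʳ x≉0)

  ·-cancelˡ : ∀ {x y z} → ¬ (x ≈ 0#) → x · y ≈ x · z → y ≈ z
  ·-cancelˡ {x} {y} {z} x≉0 eq = begin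
    y                ≈⟨ *-identityˡ y ⟨
    1# · y           ≈⟨ *-congʳ (inv-inverseˡ x≉0) ⟨
    inv x · x · y    ≈⟨ *-assoc _ _ _ ⟩
    inv x · (x · y)  ≈⟨ *-congˡ eq ⟩
    inv x · (x · z)  ≈⟨ *-assoc _ _ _ ⟨
    inv x · x · z    ≈⟨ *-congʳ (inv-inverseˡ x≉0) ⟩
    1# · z           ≈⟨ *-identityˡ z ⟩
    z                ∎
    where open import Relation.Binary.Reasoning.Setoid setoid

  ·-integral : ∀ {x y} → ¬ (x ≈ 0#) → x · y ≈ 0# → y ≈ 0#
  ·-integral x≉0 eq = ·-cancelˡ x≉0 (trans eq (sym (zeroʳ _)))

  x-y≈0⇒x≈y : ∀ {x y} → x ⊖ y ≈ 0# → x ≈ y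
  x-y≈0⇒x≈y {x} {y} eq = begin
    x            ≈⟨ solve 2 (λ x y → x := x :- y :+ y) refl x y ⟩
    x ⊖ y ⊕ y    ≈⟨ +-congʳ eq ⟩
    0# ⊕ y       ≈⟨ +-identityˡ y ⟩
    y            ∎
    where open import Relation.Binary.Reasoning.Setoid setoid

  x≈y⇒x-y≈0 : ∀ {x y} → x ≈ y → x ⊖ y ≈ 0#
  x≈y⇒x-y≈0 {x} {y} eq = trans (+-congʳ eq) (-‿inverseʳ y)

  K0 : K 0#
  K0 = proj₁ (proj₂ K-subfield)
  K1 : K 1#
  K1 = proj₁ (proj₂ (proj₂ K-subfield))
  K⊕ : ∀ {x y} → K x → K y → K (x ⊕ y)
  K⊕ = proj₁ (proj₂ (proj₂ (proj₂ K-subfield)))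
  K⊝ : ∀ {x} → K x → K (⊝ x)
  K⊝ = proj₁ (proj₂ (proj₂ (proj₂ (proj₂ K-subfield))))
  K· : ∀ {x y} → K x → K y → K (x · y)
  K· = proj₁ (proj₂ (proj₂ (proj₂ (proj₂ (proj₂ K-subfield)))))
  Kinv : ∀ {x} → K x → ¬ (x ≈ 0#) → K (inv x)
  Kinv Kx x≉0 = proj₂ (proj₂ (proj₂ (proj₂ (proj₂ (proj₂ K-subfield))))) Kx x≉0 (inv-inverseʳ x≉0)
  K⊖ : ∀ {x y} → K x → K y → K (x ⊖ y)
  K⊖ Kx Ky = K⊕ Kx (K⊝ Ky)

  κ : Fin q → Carrier
  κ = proj₁ K-count
  K-κ : ∀ i → K (κ i)
  K-κ = proj₁ (proj₂ K-count)
  κ-injective : ∀ i j → κ i ≈ κ j → i ≡ j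
  κ-injective = proj₁ (proj₂ (proj₂ K-count))
  κ-surjective : ∀ c → K c → ∃ λ i → κ i ≈ c
  κ-surjective = proj₂ (proj₂ (proj₂ K-count))

  sumL : (Carrier → ℕ) → ℕ
  sumL f = sum (λ i → f (e i))

  sumL-cong : ∀ {f g : Carrier → ℕ} → (∀ x → f x ≡ g x) → sumL f ≡ sumL g
  sumL-cong h = sum-cong-≗ (λ i → h (e i))

  sumL-unique : {P : Carrier → Set} (P? : ∀ x → Dec (P x)) → (∀ {x y} → x ≈ y → P x → P y) →
    ∀ x → P x → (∀ y → P y → y ≈ x) → sumL (λ y → [ P? y ]) ≡ 1
  sumL-unique P? P-resp x Px uniq = sum-unique (λ i → P? (e i)) (index x) (P-resp (sym (e-index x)) Px)
    (λ j Pj → e-injective _ _ (trans (uniq (e j) Pj) (sym (e-index x))))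

  sumL-zero : sumL (λ x → [ x ≈? 0# ]) ≡ 1
  sumL-zero = sumL-unique (_≈? 0#) (λ x≈y x≈0 → trans (sym x≈y) x≈0) 0# refl (λ _ y≈0 → y≈0)

  -- The value `h (e i)` is merely `≈` to an enumerated element, so the permutation of `Fin N`
  -- passes through `index` and `F` has to respect `≈`.
  sumL-bijection : (F : Carrier → ℕ) → (∀ {x y} → x ≈ y → F x ≡ F y) →
    (h g : Carrier → Carrier) → (∀ {x y} → x ≈ y → h x ≈ h y) → (∀ {x y} → x ≈ y → g x ≈ g y) →
    (∀ x → h (g x) ≈ x) → (∀ x → g (h x) ≈ x) → sumL (λ x → F (h x)) ≡ sumL F
  sumL-bijection F F-cong h g h-cong g-cong hg gh = ≡.trans
    (sum-cong-≗ (λ i → F-cong (sym (e-index (h (e i))))))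
    (≡.sym (sum-permute (λ i → F (e i)) (permutation (λ i → index (h (e i))) (λ i → index (g (e i)))
      (inverse h g h-cong hg) (inverse g h g-cong gh))))
    where
    inverse : ∀ h g → (∀ {x y} → x ≈ y → h x ≈ h y) → (∀ x → h (g x) ≈ x) →
      ∀ i → index (h (e (index (g (e i))))) ≡ i
    inverse h g h-cong hg i = e-injective _ _
      (trans (e-index _) (trans (h-cong (e-index _)) (hg (e i))))

  sumL-translate : (F : Carrier → ℕ) → (∀ {x y} → x ≈ y → F x ≡ F y) → ∀ a → sumL (λ x → F (x ⊖ a)) ≡ sumL F
  sumL-translate F F-cong a = sumL-bijection F F-cong (_⊖ a) (_⊕ a) +-congʳ +-congʳ
    (λ x → solve 2 (λ x a → x :+ a :- a := x) refl x a)
    (λ x → solve 2 (λ x a → x :- a :+ a := x) refl x a)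

  sumL-scale : ∀ {c} (F : Carrier → ℕ) → (∀ {x y} → x ≈ y → F x ≡ F y) → ¬ (c ≈ 0#) → sumL (λ x → F (x · c)) ≡ sumL F
  sumL-scale {c} F F-cong c≉0 = sumL-bijection F F-cong (_· c) (_· inv c) *-congʳ *-congʳ
    (λ x → trans (*-assoc _ _ _) (trans (*-congˡ (inv-inverseˡ c≉0)) (*-identityʳ x)))
    (λ x → trans (*-assoc _ _ _) (trans (*-congˡ (inv-inverseʳ c≉0)) (*-identityʳ x)))

  -- Decidable membership is a field so that sizes are sums of indicators. The subspaces of the
  -- statement carry no such decision and are reached through their bases.
  record Subspace : Set₁ where
    field
      member : Pred Carrier 0ℓ
      resp : ∀ {x y} → x ≈ y → member x → member y
      0∈ : member 0#
      ⊕∈ : ∀ {x y} → member x → member y → member (x ⊕ y)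
      ·∈ : ∀ {c x} → K c → member x → member (c · x)
      member? : ∀ x → Dec (member x)

    ⊖∈ : ∀ {x y} → member x → member y → member (x ⊖ y)
    ⊖∈ {x} {y} x∈ y∈ = resp (solve 2 (λ x y → x :+ (:- :1) :* y := x :- y) refl x y)
      (⊕∈ x∈ (·∈ (K⊝ K1) y∈))

    cancel-scalar : ∀ {c x} → K c → ¬ (c ≈ 0#) → member (c · x) → member x
    cancel-scalar {c} {x} Kc c≉0 cx∈ = resp
      (trans (sym (*-assoc _ _ _)) (trans (*-congʳ (inv-inverseˡ c≉0)) (*-identityˡ x)))
      (·∈ (Kinv Kc c≉0) cx∈)

    isSubspace : IsSubspace K member
    isSubspace = resp , 0∈ , ⊕∈ , ·∈

  open Subspace public

  infix 4 _∈_ _∉_ _⊆_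
  _∈_ _∉_ : Carrier → Subspace → Set
  x ∈ W = member W x
  x ∉ W = ¬ (x ∈ W)

  _⊆_ : Subspace → Subspace → Set
  W ⊆ X = ∀ {x} → x ∈ W → x ∈ X

  #_ : Subspace → ℕ
  # W = sumL (λ x → [ member? W x ])

  #-cong : ∀ W X → W ⊆ X → X ⊆ W → # W ≡ # X
  #-cong W X W⊆X X⊆W = sumL-cong (λ x → []-cong (member? W x) (member? X x) W⊆X X⊆W)

  indicator-cong : ∀ W {x y} → x ≈ y → [ member? W x ] ≡ [ member? W y ]
  indicator-cong W x≈y = []-cong (member? W _) (member? W _) (resp W x≈y) (resp W (sym x≈y))

  ⊆∧#≡⇒⊇ : ∀ W X → W ⊆ X → # W ≡ # X → X ⊆ W
  ⊆∧#≡⇒⊇ W X W⊆X #≡ {x} x∈X = resp W (e-index x) ([]-witness (member? W (e i)) (≡.trans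
      (sum-≤-≡⇒≗ _ _ (λ i → []-mono (member? W (e i)) (member? X (e i)) W⊆X) #≡ i)
      ([]-yes (member? X (e i)) (resp X (sym (e-index x)) x∈X))))
    where i = index x

  Zero : Subspace
  Zero .member x = x ≈ 0#
  Zero .resp x≈y x≈0 = trans (sym x≈y) x≈0
  Zero .0∈ = refl
  Zero .⊕∈ x≈0 y≈0 = trans (+-cong x≈0 y≈0) (+-identityˡ 0#)
  Zero .·∈ _ x≈0 = trans (*-congˡ x≈0) (zeroʳ _)
  Zero .member? x = x ≈? 0#

  -- The coefficient of `v` is part of a membership proof. For `V (suc k)` it is the coefficient of
  -- degree `k`, which later arguments read off directly.
  Ext : Carrier → Subspace → Subspace
  Ext v W .member x = Σ Carrier λ c → K c × x ⊖ c · v ∈ W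
  Ext v W .resp x≈y (c , Kc , h) = c , Kc , resp W (+-congʳ x≈y) h
  Ext v W .0∈ = 0# , K0 , resp W (solve 1 (λ v → :0 := :0 :- :0 :* v) refl v) (0∈ W)
  Ext v W .⊕∈ {x} {y} (c , Kc , h) (d , Kd , k) = c ⊕ d , K⊕ Kc Kd ,
    resp W (solve 5 (λ x y c d v → (x :- c :* v) :+ (y :- d :* v) := x :+ y :- (c :+ d) :* v) refl x y c d v) (⊕∈ W h k)
  Ext v W .·∈ {a} {x} Ka (c , Kc , h) = a · c , K· Ka Kc ,
    resp W (solve 4 (λ a x c v → a :* (x :- c :* v) := a :* x :- a :* c :* v) refl a x c v) (·∈ W Ka h)
  Ext v W .member? x = map′
    (λ (i , h) → κ i , K-κ i , h)
    (λ (c , Kc , h) → let i , κi≈c = κ-surjective c Kc in i , resp W (+-congˡ (-‿cong (*-congʳ (sym κi≈c)))) h)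
    (any? (λ i → member? W (x ⊖ κ i · v)))

  ⊆Ext : ∀ v W → W ⊆ Ext v W
  ⊆Ext v W {x} x∈ = 0# , K0 , resp W (solve 2 (λ x v → x := x :- :0 :* v) refl x v) x∈

  v∈Ext : ∀ v W → v ∈ Ext v W
  v∈Ext v W = 1# , K1 , resp W (solve 1 (λ v → :0 := v :- :1 :* v) refl v) (0∈ W)

  Ext-⊆ : ∀ v W X → W ⊆ X → v ∈ X → Ext v W ⊆ X
  Ext-⊆ v W X W⊆X v∈X {x} (c , Kc , h) =
    resp X (solve 3 (λ x c v → (x :- c :* v) :+ c :* v := x) refl x c v) (⊕∈ X (W⊆X h) (·∈ X Kc v∈X))

  -- Otherwise subtraction puts a nonzero multiple of `v` into `W`. The fact is used twice: it makes
  -- the translates of `W` that form `Ext v W` disjoint, and with `v` a power of α it compares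
  -- coefficients of polynomials.
  coefficient-unique : ∀ W {v x c d} → v ∉ W → K c → K d → x ⊖ c · v ∈ W → x ⊖ d · v ∈ W → c ≈ d
  coefficient-unique W {v} {x} {c} {d} v∉W Kc Kd h k with (d ⊖ c) ≈? 0#
  ... | yes d-c≈0 = sym (x-y≈0⇒x≈y d-c≈0)
  ... | no d-c≉0 = contradiction
    (cancel-scalar W (K⊖ Kd Kc) d-c≉0
      (resp W (solve 4 (λ x c d v → (x :- c :* v) :- (x :- d :* v) := (d :- c) :* v) refl x c d v) (⊖∈ W h k)))
    v∉W

  #-Ext : ∀ v W → v ∉ W → # (Ext v W) ≡ q * # W
  #-Ext v W v∉W = begin
    # (Ext v W)                                                    ≡⟨ sumL-cong split ⟩
    sumL (λ x → sum (λ i → [ member? W (x ⊖ κ i · v) ]))           ≡⟨ ∑-comm (λ j i → [ member? W (e j ⊖ κ i · v) ]) ⟩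
    sum (λ i → sumL (λ x → [ member? W (x ⊖ κ i · v) ]))           ≡⟨ sum-cong-≗ (λ i → sumL-translate (λ x → [ member? W x ]) (indicator-cong W) (κ i · v)) ⟩
    sum {q} (λ i → # W)                                            ≡⟨ sum-const q (# W) ⟩
    q * # W                                                        ∎
    where
    open ≡-Reasoning
    split : ∀ x → [ member? (Ext v W) x ] ≡ sum (λ i → [ member? W (x ⊖ κ i · v) ])
    split x with any? (λ i → member? W (x ⊖ κ i · v))
    ... | no none = ≡.sym (sum-none _ (λ i h → none (i , h)))
    ... | yes (i , h) = ≡.sym (sum-unique _ i h
      (λ j k → κ-injective j i (coefficient-unique W v∉W (K-κ j) (K-κ i) k h)))

-- Polynomials in α of bounded degree

module SimpleExtension
  (L : CommutativeRing 0ℓ 0ℓ) (L-field : FieldTheory.IsField L)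
  (K : Pred (CommutativeRing.Carrier L) 0ℓ) (K-subfield : FieldTheory.IsSubfield L K)
  (q d : ℕ) (1<q : 1 < q) (K-count : CountedBy K (CommutativeRing._≈_ L) q)
  (L-count : CountedBy (λ (_ : CommutativeRing.Carrier L) → ⊤) (CommutativeRing._≈_ L) (q ^ d))
  (α : CommutativeRing.Carrier L) (generates : FieldTheory.Generates L K α)
  where

  open FiniteExtension L L-field K K-subfield q (q ^ d) K-count L-count public

  V : ℕ → Subspace
  V zero = Zero
  V (suc k) = Ext (pow α k) (V k)

  V-mono : ∀ {j k} → j ≤ k → V j ⊆ V k
  V-mono {j} {k} j≤k = go (ℕ.≤⇒≤′ j≤k)
    where
    go : ∀ {k} → j ≤′ k → V j ⊆ V k
    go (≤′-reflexive ≡.refl) x∈ = x∈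
    go {suc k} (≤′-step j≤k) x∈ = ⊆Ext (pow α k) (V k) (go j≤k x∈)

  α·V : ∀ k {x} → x ∈ V k → α · x ∈ V (suc k)
  α·V zero x≈0 = resp (V 1) (sym (trans (*-congˡ x≈0) (zeroʳ α))) (0∈ (V 1))
  α·V (suc k) {x} (c , Kc , h) = c , Kc ,
    resp (V (suc k)) (solve 4 (λ α x c v → α :* (x :- c :* v) := α :* x :- c :* (α :* v)) refl α x c (pow α k)) (α·V k h)

  pow·V : ∀ i j {x} → x ∈ V j → pow α i · x ∈ V (i + j)
  pow·V zero j x∈ = resp (V j) (sym (*-identityˡ _)) x∈
  pow·V (suc i) j x∈ = resp (V (suc i + j)) (sym (*-assoc _ _ _)) (α·V (i + j) (pow·V i j x∈))

  V·V : ∀ i j {x y} → x ∈ V i → y ∈ V j → x · y ∈ V (i + j)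
  V·V zero j {x} {y} x≈0 y∈ = resp (V j) (sym (trans (*-congʳ x≈0) (zeroˡ y))) (0∈ (V j))
  -- The product already lies in `V (i + j)`; `⊆Ext` gives away one degree to meet the stated bound.
  V·V (suc i) j {x} {y} (c , Kc , h) y∈ = ⊆Ext (pow α (i + j)) (V (i + j))
    (resp (V (i + j)) (solve 4 (λ x y c v → (x :- c :* v) :* y :+ c :* (v :* y) := x :* y) refl x y c (pow α i))
      (⊕∈ (V (i + j)) (V·V i j h y∈) (·∈ (V (i + j)) Kc (pow·V i j y∈))))

  pow-add : ∀ x i j → pow x (i + j) ≈ pow x i · pow x j
  pow-add x zero j = sym (*-identityˡ _)
  pow-add x (suc i) j = trans (*-congˡ (pow-add x i j)) (sym (*-assoc _ _ _))

  pow-period : ∀ {x} → ¬ (x ≈ 0#) → ∀ i j → i < j → pow x i ≈ pow x j → ∃ λ m → x · pow x m ≈ 1#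
  pow-period x≉0 zero (suc j) _ eq = j , sym eq
  pow-period x≉0 (suc i) (suc j) (s≤s i<j) eq = pow-period x≉0 i j i<j (·-cancelˡ x≉0 eq)

  -- Two of the first `q ^ d + 1` powers of `x` coincide, and cancelling the smaller one leaves a
  -- positive power equal to one. Closure under products will then give closure under inverses.
  inverse-is-power : ∀ {x} → ¬ (x ≈ 0#) → ∃ λ m → x · pow x m ≈ 1#
  inverse-is-power {x} x≉0 with pigeonhole (ℕ.n<1+n (q ^ d)) (λ i → index (pow x (toℕ i)))
  ... | i , j , i<j , eq = pow-period x≉0 (toℕ i) (toℕ j) i<j
    (trans (sym (e-index _)) (trans (reflexive (≡.cong e eq)) (e-index _)))

  1∈V : ∀ k → 1# ∈ V (suc k)
  1∈V k = V-mono {1} {suc k} (s≤s z≤n) (v∈Ext 1# Zero)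

  module _ {k} (pow∈V : pow α k ∈ V k) where

    α·V⊆V : ∀ {x} → x ∈ V k → α · x ∈ V k
    α·V⊆V x∈ = Ext-⊆ (pow α k) (V k) (V k) (λ h → h) pow∈V (α·V k x∈)

    V·V⊆V : ∀ i {x y} → x ∈ V i → y ∈ V k → x · y ∈ V k
    V·V⊆V zero {x} {y} x≈0 y∈ = resp (V k) (sym (trans (*-congʳ x≈0) (zeroˡ y))) (0∈ (V k))
    V·V⊆V (suc i) {x} {y} (c , Kc , h) y∈ =
      resp (V k) (solve 4 (λ x y c v → (x :- c :* v) :* y :+ c :* (v :* y) := x :* y) refl x y c (pow α i))
        (⊕∈ (V k) (V·V⊆V i h y∈) (·∈ (V k) Kc (pow· i)))
      where
      pow· : ∀ i → pow α i · y ∈ V k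
      pow· zero = resp (V k) (sym (*-identityˡ y)) y∈
      pow· (suc i) = resp (V k) (sym (*-assoc _ _ _)) (α·V⊆V (pow· i))

    -- Once `pow α k` reduces to lower powers, `V k` is closed under multiplication by α, hence
    -- under products, hence under inverses. It is then a subfield containing `K` and α.
    V-everything : ∀ x → x ∈ V k
    V-everything = generates (member (V k))
      ( resp (V k) , 0∈ (V k) , 1∈ , ⊕∈ (V k)
      , (λ {x} x∈ → resp (V k) (+-identityˡ (⊝ x)) (⊖∈ (V k) (0∈ (V k)) x∈))
      , V·V⊆V k
      , λ {x} {y} x∈ x≉0 xy≈1 → let m , eq = inverse-is-power x≉0 in
          resp (V k) (·-cancelˡ x≉0 (trans eq (sym xy≈1))) (pow∈ x∈ m) )
      (λ {c} Kc → resp (V k) (*-identityʳ c) (·∈ (V k) Kc 1∈))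
      (resp (V k) (*-identityʳ α) (α·V⊆V 1∈))
      where
      -- `V 0` does not contain one, but for `k = 0` the hypothesis itself reads `1# ≈ 0#`.
      nonempty : ∀ j → pow α j ∈ V j → 1# ∈ V j
      nonempty zero 1≈0 = contradiction 1≈0 1≉0
      nonempty (suc j) _ = 1∈V j
      1∈ : 1# ∈ V k
      1∈ = nonempty k pow∈V
      pow∈ : ∀ {x} → x ∈ V k → ∀ m → pow x m ∈ V k
      pow∈ x∈ zero = 1∈
      pow∈ x∈ (suc m) = V·V⊆V k x∈ (pow∈ x∈ m)

  #-V : ∀ k → k ≤ d → # V k ≡ q ^ k
  -- Mutual with the size of `V k`: each new power multiplies the size by `q` because it lies
  -- outside, and it lies outside because `V k`, of size `q ^ k < q ^ d`, cannot be all of `L`.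
  pow∉V : ∀ k → k < d → pow α k ∉ V k

  #-V zero _ = sumL-zero
  #-V (suc k) k<d = ≡.trans (#-Ext (pow α k) (V k) (pow∉V k k<d)) (≡.cong (q *_) (#-V k (ℕ.<⇒≤ k<d)))

  pow∉V k k<d pow∈V = ℕ.<-irrefl q^k≡q^d (ℕ.^-monoʳ-< q 1<q k<d)
    where
    open ≡-Reasoning
    q^k≡q^d : q ^ k ≡ q ^ d
    q^k≡q^d = begin
      q ^ k                                  ≡⟨ #-V k (ℕ.<⇒≤ k<d) ⟨
      # V k                                  ≡⟨ sumL-cong (λ x → []-yes (member? (V k) x) (V-everything {k} pow∈V x)) ⟩
      sumL (λ _ → 1)                         ≡⟨ sum-const (q ^ d) 1 ⟩
      q ^ d * 1                              ≡⟨ ℕ.*-identityʳ _ ⟩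
      q ^ d                                  ∎

  -- A nonzero coefficient of degree `k` in `x` would express `pow α (suc k)` through lower powers,
  -- which `suc k < d` forbids.
  α·-cancel-V : ∀ k {x} → suc k < d → x ∈ V (suc k) → α · x ∈ V (suc k) → x ∈ V k
  α·-cancel-V k {x} k<d (c , Kc , h) αx∈ with c ≈? 0#
  ... | yes c≈0 = resp (V k)
      (trans (+-congˡ (-‿cong (*-congʳ c≈0))) (solve 2 (λ x v → x :- :0 :* v := x) refl x (pow α k))) h
  ... | no c≉0 = contradiction
      (cancel-scalar (V (suc k)) Kc c≉0 (resp (V (suc k))
        (solve 4 (λ α x c v → α :* x :- α :* (x :- c :* v) := c :* (α :* v)) refl α x c (pow α k))
        (⊖∈ (V (suc k)) αx∈ (α·V k h))))
      (pow∉V (suc k) k<d)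

  -- With `v = pow α k`, the remainder is `(x - a v) (y - b v) + a v (y - b v) + b v (x - a
  -- v)`, and every summand has degree below `k + k`.
  top-product : ∀ k {x y a b} → K a → K b → x ⊖ a · pow α k ∈ V k → y ⊖ b · pow α k ∈ V k →
    x · y ⊖ (a · b) · pow α (k + k) ∈ V (k + k)
  top-product k {x} {y} {a} {b} Ka Kb h h′ = resp W
      (trans (solve 5 (λ x y a b v →
          (x :- a :* v) :* (y :- b :* v) :+ (a :* (v :* (y :- b :* v)) :+ b :* (v :* (x :- a :* v)))
          := x :* y :- (a :* b) :* (v :* v)) refl x y a b (pow α k))
        (+-congˡ (-‿cong (*-congˡ (sym (pow-add α k k))))))
      (⊕∈ W (V·V k k h h′) (⊕∈ W (·∈ W Ka (pow·V k k h′)) (·∈ W Kb (pow·V k k h))))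
    where W = V (k + k)

  eliminate-top : ∀ k {x y a b c} → K c → a ≈ c · b → x ⊖ a · pow α k ∈ V k → y ⊖ b · pow α k ∈ V k →
    x ⊖ c · y ∈ V k
  eliminate-top k {x} {y} {a} {b} {c} Kc a≈cb h h′ = resp (V k)
      (trans (+-congʳ (+-congˡ (-‿cong (*-congʳ a≈cb))))
        (solve 5 (λ x y b c v → (x :- (c :* b) :* v) :- c :* (y :- b :* v) := x :- c :* y) refl x y b c (pow α k)))
      (⊖∈ (V k) h (·∈ (V k) Kc h′))

  -- Bounded-degree elements whose product with β is again of bounded degree

  U : ℕ → Carrier → Subspace
  U k β .member x = x ∈ V k × x · β ∈ V k
  U k β .resp x≈y (h , h′) = resp (V k) x≈y h , resp (V k) (*-congʳ x≈y) h′
  U k β .0∈ = 0∈ (V k) , resp (V k) (sym (zeroˡ β)) (0∈ (V k))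
  U k β .⊕∈ (h , h′) (l , l′) = ⊕∈ (V k) h l , resp (V k) (sym (distribʳ _ _ _)) (⊕∈ (V k) h′ l′)
  U k β .·∈ Kc (h , h′) = ·∈ (V k) Kc h , resp (V k) (sym (*-assoc _ _ _)) (·∈ (V k) Kc h′)
  U k β .member? x = member? (V k) x ×-dec member? (V k) (x · β)

  U⊆U : ∀ k β → U k β ⊆ U (suc k) β
  U⊆U k β (h , h′) = ⊆Ext (pow α k) (V k) h , ⊆Ext (pow α k) (V k) h′

  -- Multiplying by α raises the degree, so a nonzero element of U (suc k) β produces one of top degree.
  U-top : ∀ k β {g} → k < d → g ∈ U (suc k) β → ¬ (g ≈ 0#) → ∃ λ g₀ → g₀ ∈ U (suc k) β × g₀ ∉ U k β
  U-top k β {g} k<d g∈ g≉0 with member? (U k β) g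
  ... | no g∉ = g , g∈ , g∉
  U-top zero β k<d g∈ g≉0 | yes (g≈0 , _) = contradiction g≈0 g≉0
  U-top (suc k) β k<d g∈ g≉0 | yes g∈′ with U-top k β (ℕ.<⇒≤ k<d) g∈′ g≉0
  ... | g₁ , (h , h′) , g₁∉ = α · g₁ ,
    (α·V (suc k) h , resp (V (suc (suc k))) (sym (*-assoc _ _ _)) (α·V (suc k) h′)) ,
    λ (l , l′) → g₁∉ (α·-cancel-V k k<d h l ,
      α·-cancel-V k k<d h′ (resp (V (suc k)) (*-assoc _ _ _) l′))

  module _ {a b a₀ b₀} (ab₀≈a₀b : a · b₀ ≈ a₀ · b) (a₀≉0 : ¬ (a₀ ≈ 0#)) where
    ratio₁ : a ≈ (a · inv a₀) · a₀
    ratio₁ = sym (trans (*-assoc _ _ _) (trans (*-congˡ (inv-inverseˡ a₀≉0)) (*-identityʳ a)))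

    ratio₂ : b ≈ (a · inv a₀) · b₀
    ratio₂ = ·-cancelˡ a₀≉0 (trans (sym ab₀≈a₀b) (sym (trans
      (solve 4 (λ a i a₀ b₀ → a₀ :* ((a :* i) :* b₀) := (i :* a₀) :* (a :* b₀)) refl a (inv a₀) a₀ b₀)
      (trans (*-congʳ (inv-inverseˡ a₀≉0)) (*-identityˡ _)))))

  -- The leading coefficients `(a , b)` of `g` and `g · β` are proportional to `(a₀ , b₀)`, which is
  -- not zero because `g₀ ∉ U k β`. Subtracting the right multiple of `g₀` removes both at once. The
  -- bound `k + k < d` makes the coefficient of degree `k + k` well defined.
  U⊆Ext : ∀ k β {g₀} → k + k < d → g₀ ∈ U (suc k) β → g₀ ∉ U k β → U (suc k) β ⊆ Ext g₀ (U k β)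
  U⊆Ext k β {g₀} 2k<d ((a₀ , Ka₀ , h₀) , (b₀ , Kb₀ , l₀)) g₀∉ {g} ((a , Ka , h) , (b , Kb , l)) = result
    where
    -- Both sides are the coefficient of degree 2k in g (g₀ β) = g₀ (g β).
    ab₀≈a₀b : a · b₀ ≈ a₀ · b
    ab₀≈a₀b = coefficient-unique (V (k + k)) (pow∉V (k + k) 2k<d) (K· Ka Kb₀) (K· Ka₀ Kb)
      (top-product k Ka Kb₀ h l₀)
      (resp (V (k + k)) (+-congʳ (solve 3 (λ g₀ g β → g₀ :* (g :* β) := g :* (g₀ :* β)) refl g₀ g β))
        (top-product k Ka₀ Kb h₀ l))
    in-ratio : ∀ {c} → K c → a ≈ c · a₀ → b ≈ c · b₀ → g ∈ Ext g₀ (U k β)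
    in-ratio {c} Kc eq eq′ = c , Kc , eliminate-top k Kc eq h h₀ ,
      resp (V k) (solve 4 (λ g β c g₀ → g :* β :- c :* (g₀ :* β) := (g :- c :* g₀) :* β) refl g β c g₀)
        (eliminate-top k Kc eq′ l l₀)
    drop : ∀ {x c} → c ≈ 0# → x ⊖ c · pow α k ∈ V k → x ∈ V k
    drop {x} c≈0 = resp (V k) (trans (+-congˡ (-‿cong (*-congʳ c≈0)))
      (solve 2 (λ x v → x :- :0 :* v := x) refl x (pow α k)))
    result : g ∈ Ext g₀ (U k β)
    result with a₀ ≈? 0# | b₀ ≈? 0#
    ... | no a₀≉0 | _ = in-ratio (K· Ka (Kinv Ka₀ a₀≉0)) (ratio₁ ab₀≈a₀b a₀≉0) (ratio₂ ab₀≈a₀b a₀≉0)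
    -- The same argument with the two leading coefficients exchanged.
    ... | yes _ | no b₀≉0 = in-ratio (K· Kb (Kinv Kb₀ b₀≉0)) (ratio₂ ba₀≈b₀a b₀≉0) (ratio₁ ba₀≈b₀a b₀≉0)
      where
      ba₀≈b₀a : b · a₀ ≈ b₀ · a
      ba₀≈b₀a = trans (*-comm b a₀) (trans (sym ab₀≈a₀b) (*-comm a b₀))
    ... | yes a₀≈0 | yes b₀≈0 = contradiction (drop a₀≈0 h₀ , drop b₀≈0 l₀) g₀∉

  #-U-step : ∀ k β {g} → k + k < d → g ∈ U (suc k) β → ¬ (g ≈ 0#) → # U (suc k) β ≡ q * # U k β
  #-U-step k β 2k<d g∈ g≉0 with U-top k β (ℕ.≤-<-trans (ℕ.m≤m+n k k) 2k<d) g∈ g≉0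
  ... | g₀ , g₀∈ , g₀∉ = ≡.trans
    (#-cong (U (suc k) β) (Ext g₀ (U k β)) (U⊆Ext k β 2k<d g₀∈ g₀∉)
      (Ext-⊆ g₀ (U k β) (U (suc k) β) (U⊆U k β) g₀∈))
    (#-Ext g₀ (U k β) g₀∉)

  sum-#-U : ∀ k → k ≤ d → sumL (λ β → # U k β) + q ^ k ≡ q ^ d + q ^ k * q ^ k
  sum-#-U k k≤d = begin
    sumL (λ β → # U k β) + q ^ k
      ≡⟨ ≡.cong₂ _+_ (∑-comm (λ i j → [ member? (U k (e i)) (e j) ])) (≡.sym (weighted _)) ⟩
    sumL (λ g → sumL (λ β → [ member? (U k β) g ])) + sumL (λ g → [ g ≈? 0# ] * q ^ k)
      ≡⟨ ∑-distrib-+ (λ i → sumL (λ β → [ member? (U k β) (e i) ])) _ ⟨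
    sumL (λ g → sumL (λ β → [ member? (U k β) g ]) + [ g ≈? 0# ] * q ^ k)
      ≡⟨ sumL-cong pointwise ⟩
    sumL (λ g → [ g ≈? 0# ] * q ^ d + [ member? (V k) g ] * q ^ k)
      ≡⟨ ∑-distrib-+ (λ i → [ e i ≈? 0# ] * q ^ d) _ ⟩
    sumL (λ g → [ g ≈? 0# ] * q ^ d) + sumL (λ g → [ member? (V k) g ] * q ^ k)
      ≡⟨ ≡.cong₂ _+_ (weighted _) (≡.trans (≡.sym (*-distribʳ-sum (q ^ k) (λ i → [ member? (V k) (e i) ]))) (≡.cong (_* q ^ k) (#-V k k≤d))) ⟩
    q ^ d + q ^ k * q ^ k ∎
    where
    open ≡-Reasoning
    weighted : ∀ c → sumL (λ g → [ g ≈? 0# ] * c) ≡ c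
    weighted c = ≡.trans (≡.sym (*-distribʳ-sum c (λ i → [ e i ≈? 0# ])))
      (≡.trans (≡.cong (_* c) sumL-zero) (ℕ.*-identityˡ c))
    -- The zero `g` admits every β. A nonzero `g` in `V k` admits as many β as `V k` has elements,
    -- since β ↦ g β is a bijection. The extra `q ^ k` at zero makes the term with `V k` uniform in
    -- `g`, without subtraction.
    pointwise : ∀ g → sumL (λ β → [ member? (U k β) g ]) + [ g ≈? 0# ] * q ^ k ≡ [ g ≈? 0# ] * q ^ d + [ member? (V k) g ] * q ^ k
    pointwise g with g ≈? 0#
    ... | yes g≈0 = ≡.cong₂ _+_
      (≡.trans (sumL-cong (λ β → []-yes (member? (U k β) g) (resp (U k β) (sym g≈0) (0∈ (U k β)))))
        (≡.trans (sum-const (q ^ d) 1) (ℕ.*-comm (q ^ d) 1)))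
      (≡.cong (_* q ^ k) (≡.sym ([]-yes (member? (V k) g) (resp (V k) (sym g≈0) (0∈ (V k))))))
    ... | no g≉0 = ≡.trans (ℕ.+-identityʳ _) (begin
      sumL (λ β → [ member? (U k β) g ])
        ≡⟨ sumL-cong (λ β → []-× (member? (V k) g) (member? (V k) (g · β))) ⟩
      sumL (λ β → [ member? (V k) g ] * [ member? (V k) (g · β) ])
        ≡⟨ *-distribˡ-sum [ member? (V k) g ] (λ i → [ member? (V k) (g · e i) ]) ⟨
      [ member? (V k) g ] * sumL (λ β → [ member? (V k) (g · β) ])
        ≡⟨ ≡.cong ([ member? (V k) g ] *_) (≡.trans
            (sumL-cong (λ β → indicator-cong (V k) (*-comm g β)))
            (sumL-scale (λ x → [ member? (V k) x ]) (indicator-cong (V k)) g≉0)) ⟩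
      [ member? (V k) g ] * # V k
        ≡⟨ ≡.cong ([ member? (V k) g ] *_) (#-V k k≤d) ⟩
      [ member? (V k) g ] * q ^ k ∎)

-- Splitting planes and their bases

module SplittingSubspaces
  (L : CommutativeRing 0ℓ 0ℓ) (L-field : FieldTheory.IsField L)
  (K : Pred (CommutativeRing.Carrier L) 0ℓ) (K-subfield : FieldTheory.IsSubfield L K)
  (r k : ℕ) (0<r : 0 < r) (K-count : CountedBy K (CommutativeRing._≈_ L) (suc r))
  (L-count : CountedBy (λ (_ : CommutativeRing.Carrier L) → ⊤) (CommutativeRing._≈_ L) (suc r ^ (2 * suc k)))
  (α : CommutativeRing.Carrier L) (generates : FieldTheory.Generates L K α)
  where

  q n N : ℕ
  q = suc r
  n = suc k
  N = q ^ (2 * n)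

  open SimpleExtension L L-field K K-subfield q (2 * n) (s≤s 0<r) K-count L-count α generates public

  N≡q^n*q^n : N ≡ q ^ n * q ^ n
  N≡q^n*q^n = ≡.trans (≡.cong (λ m → q ^ (n + m)) (ℕ.+-identityʳ n)) (ℕ.^-distribˡ-+-* q n n)

  n≤2n : n ≤ 2 * n
  n≤2n = ℕ.m≤m+n n (n + 0)

  k+k<2n : k + k < 2 * n
  k+k<2n = s≤s (ℕ.+-monoʳ-≤ k (ℕ.≤-trans (ℕ.n≤1+n k) (ℕ.m≤m+n n 0)))

  -- The number of good ratios

  Good : Carrier → Set
  Good β = ∀ g → g ∈ U n β → g ≈ 0#

  Good? : ∀ β → Dec (Good β)
  Good? β = all-dec (λ g → member? (U n β) g →-dec (g ≈? 0#))
    (λ x≈y h y∈ → trans (sym x≈y) (h (resp (U n β) (sym x≈y) y∈)))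

  Good-resp : ∀ {β γ} → β ≈ γ → Good β → Good γ
  Good-resp β≈γ h g (g∈ , gγ∈) = h g (g∈ , resp (V n) (*-congˡ (sym β≈γ)) gγ∈)

  #-U-Good : ∀ β → # U n β + r * [ Good? β ] ≡ q * # U k β
  #-U-Good β with any? (λ i → member? (U n β) (e i) ×-dec ¬? (e i ≈? 0#))
  ... | yes (i , g∈ , g≉0) = ≡.trans
    (≡.cong₂ _+_ (#-U-step k β k+k<2n g∈ g≉0)
      (≡.trans (≡.cong (r *_) ([]-no (Good? β) (λ good → g≉0 (good (e i) g∈)))) (ℕ.*-zeroʳ r)))
    (ℕ.+-identityʳ _)
  -- Both spaces are zero here, and the claim reads `1 + r = q`.
  ... | no none = ≡.trans
    (≡.cong₂ _+_ (#≡1 (U n β) good) (≡.cong (r *_) ([]-yes (Good? β) good)))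
    (≡.sym (≡.cong (q *_) (#≡1 (U k β) (λ g g∈ → good g (U⊆U k β g∈)))))
    where
    good : Good β
    good g g∈ with g ≈? 0#
    ... | yes g≈0 = g≈0
    ... | no g≉0 = contradiction
      (index g , resp (U n β) (sym (e-index g)) g∈ , λ eq → g≉0 (trans (sym (e-index g)) eq)) none
    #≡1 : ∀ W → (∀ g → g ∈ W → g ≈ 0#) → # W ≡ 1
    #≡1 W h = ≡.trans (#-cong W Zero (h _) (λ x≈0 → resp W (sym x≈0) (0∈ W))) sumL-zero

  #Good : ℕ
  #Good = sumL (λ β → [ Good? β ])

  #Good-value : #Good ≡ r * (q * (q ^ k * q ^ k))
  #Good-value = ℕ.*-cancelˡ-≡ _ _ r {{ℕ.>-nonZero 0<r}}
    -- Adding this amount, which equals `A + q * x`, avoids subtraction: the summand `q * x` joins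
    -- `q * B` to give `q * (B + x)`, whose value is known.
    (ℕ.+-cancelˡ-≡ (N + (q * x) * (q * x)) _ _ (begin
      N + (q * x) * (q * x) + r * #Good      ≡⟨ ≡.cong (_+ r * #Good) (sum-#-U n n≤2n) ⟨
      A + q * x + r * #Good                  ≡⟨ swap A (q * x) (r * #Good) ⟩
      A + r * #Good + q * x                  ≡⟨ ≡.cong (_+ q * x) total ⟩
      q * B + q * x                          ≡⟨ ℕ.*-distribˡ-+ q B x ⟨
      q * (B + x)                            ≡⟨ ≡.cong (q *_) (sum-#-U k (ℕ.≤-trans (ℕ.n≤1+n k) n≤2n)) ⟩
      q * (N + x * x)                        ≡⟨ ≡.cong (λ N → q * (N + x * x)) N≡q^n*q^n ⟩
      q * ((q * x) * (q * x) + x * x)        ≡⟨ identity r x ⟩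
      (q * x) * (q * x) + (q * x) * (q * x) + r * (r * (q * (x * x)))
        ≡⟨ ≡.cong (λ N → N + (q * x) * (q * x) + r * (r * (q * (x * x)))) N≡q^n*q^n ⟨
      N + (q * x) * (q * x) + r * (r * (q * (x * x))) ∎))
    where
    open ≡-Reasoning
    x = q ^ k
    A = sumL (λ β → # U n β)
    B = sumL (λ β → # U k β)
    total : A + r * #Good ≡ q * B
    total = begin
      A + r * #Good                                    ≡⟨ ≡.cong (A +_) (*-distribˡ-sum r (λ i → [ Good? (e i) ])) ⟩
      A + sumL (λ β → r * [ Good? β ])                 ≡⟨ ∑-distrib-+ (λ i → # U n (e i)) _ ⟨
      sumL (λ β → # U n β + r * [ Good? β ])           ≡⟨ sumL-cong #-U-Good ⟩
      sumL (λ β → q * # U k β)                         ≡⟨ *-distribˡ-sum q (λ i → # U k (e i)) ⟨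
      q * B                                            ∎
    swap : ∀ a b c → a + b + c ≡ a + c + b
    swap = solve-∀
    identity : ∀ r x → suc r * ((suc r * x) * (suc r * x) + x * x)
      ≡ (suc r * x) * (suc r * x) + (suc r * x) * (suc r * x) + r * (r * (suc r * (x * x)))
    identity = solve-∀

  -- Good pairs and independence over `V n`

  GoodPair : Carrier → Carrier → Set
  GoodPair w₁ w₂ = ¬ (w₁ ≈ 0#) × Good (w₂ · inv w₁)

  GoodPair? : ∀ w₁ w₂ → Dec (GoodPair w₁ w₂)
  GoodPair? w₁ w₂ = ¬? (w₁ ≈? 0#) ×-dec Good? (w₂ · inv w₁)

  sumL-minus : {P Q : Carrier → Set} (P? : ∀ x → Dec (P x)) (Q? : ∀ x → Dec (Q x)) → (∀ {x} → Q x → P x) →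
    sumL (λ x → [ P? x ×-dec ¬? (Q? x) ]) ≡ sumL (λ x → [ P? x ]) ∸ sumL (λ x → [ Q? x ])
  sumL-minus P? Q? Q⊆P = ≡.trans (≡.sym (ℕ.m+n∸n≡m _ (sumL (λ x → [ Q? x ]))))
    (≡.cong (_∸ sumL (λ x → [ Q? x ])) (≡.trans (≡.sym (∑-distrib-+ (λ i → [ P? (e i) ×-dec ¬? (Q? (e i)) ]) _)) (sumL-cong split)))
    where
    split : ∀ x → [ P? x ×-dec ¬? (Q? x) ] + [ Q? x ] ≡ [ P? x ]
    split x with P? x | Q? x
    ... | yes _ | yes _ = ≡.refl
    ... | yes _ | no _ = ≡.refl
    ... | no _ | no _ = ≡.refl
    ... | no ¬Px | yes Qx = contradiction (Q⊆P Qx) ¬Px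

  inv≉0 : ∀ {x} → ¬ (x ≈ 0#) → ¬ (inv x ≈ 0#)
  inv≉0 x≉0 inv≈0 = 1≉0 (trans (sym (inv-inverseʳ x≉0)) (trans (*-congˡ inv≈0) (zeroʳ _)))

  #GoodPair : sumL (λ w₁ → sumL (λ w₂ → [ GoodPair? w₁ w₂ ])) ≡ (N ∸ 1) * #Good
  #GoodPair = begin
    sumL (λ w₁ → sumL (λ w₂ → [ GoodPair? w₁ w₂ ]))          ≡⟨ sumL-cong inner ⟩
    -- For fixed nonzero `w₁` the ratio runs through `L` once, hence the factor `#Good`. The trivial
    -- `yes _` gives the remaining count the shape required by `sumL-minus`.
    sumL (λ w₁ → [ yes _ ×-dec ¬? (w₁ ≈? 0#) ] * #Good)      ≡⟨ *-distribʳ-sum #Good (λ i → [ yes _ ×-dec ¬? (e i ≈? 0#) ]) ⟨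
    sumL (λ w₁ → [ yes _ ×-dec ¬? (w₁ ≈? 0#) ]) * #Good      ≡⟨ ≡.cong (_* #Good) (sumL-minus {λ _ → ⊤} (λ _ → yes _) (_≈? 0#) _) ⟩
    (sumL (λ _ → 1) ∸ sumL (λ x → [ x ≈? 0# ])) * #Good      ≡⟨ ≡.cong (_* #Good) (≡.cong₂ _∸_ (≡.trans (sum-const N 1) (ℕ.*-identityʳ N)) sumL-zero) ⟩
    (N ∸ 1) * #Good                                          ∎
    where
    open ≡-Reasoning
    inner : ∀ w₁ → sumL (λ w₂ → [ GoodPair? w₁ w₂ ]) ≡ [ yes tt ×-dec ¬? (w₁ ≈? 0#) ] * #Good
    inner w₁ = ≡.trans (sumL-cong (λ w₂ → []-× (¬? (w₁ ≈? 0#)) (Good? (w₂ · inv w₁))))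
      (≡.trans (≡.sym (*-distribˡ-sum [ ¬? (w₁ ≈? 0#) ] (λ i → [ Good? (e i · inv w₁) ]))) (rescale (w₁ ≈? 0#)))
      where
      rescale : (w₁≈?0 : Dec (w₁ ≈ 0#)) →
        [ ¬? w₁≈?0 ] * sumL (λ w₂ → [ Good? (w₂ · inv w₁) ]) ≡ [ yes tt ×-dec ¬? w₁≈?0 ] * #Good
      rescale (yes _) = ≡.refl
      rescale (no w₁≉0) = ≡.cong (1 *_) (sumL-scale (λ β → [ Good? β ])
        (λ x≈y → []-cong (Good? _) (Good? _) (Good-resp x≈y) (Good-resp (sym x≈y))) (inv≉0 w₁≉0))

  Independent : Carrier → Carrier → Set
  Independent w₁ w₂ = ∀ f g → f ∈ V n → g ∈ V n → f · w₁ ⊕ g · w₂ ≈ 0# → f ≈ 0# × g ≈ 0#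

  -- Dividing the relation by `w₁` gives `g β = - f`, which puts `g` into `U n β`.
  GoodPair⇒Independent : ∀ {w₁ w₂} → GoodPair w₁ w₂ → Independent w₁ w₂
  GoodPair⇒Independent {w₁} {w₂} (w₁≉0 , good) f g f∈ g∈ eq = f≈0 , g≈0
    where
    open import Relation.Binary.Reasoning.Setoid setoid
    gβ≈-f : ⊝ f ≈ g · (w₂ · inv w₁)
    gβ≈-f = begin
      ⊝ f                                             ≈⟨ *-identityʳ _ ⟨
      ⊝ f · 1#                                        ≈⟨ *-congˡ (inv-inverseʳ w₁≉0) ⟨
      ⊝ f · (w₁ · inv w₁)                             ≈⟨ solve 5 (λ f g w₁ w₂ i → (:- f) :* (w₁ :* i) := g :* (w₂ :* i) :- (f :* w₁ :+ g :* w₂) :* i) refl f g w₁ w₂ (inv w₁) ⟩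
      g · (w₂ · inv w₁) ⊖ (f · w₁ ⊕ g · w₂) · inv w₁  ≈⟨ +-congˡ (-‿cong (trans (*-congʳ eq) (zeroˡ _))) ⟩
      g · (w₂ · inv w₁) ⊖ 0#                          ≈⟨ solve 1 (λ x → x :- :0 := x) refl _ ⟩
      g · (w₂ · inv w₁)                               ∎
    g≈0 : g ≈ 0#
    g≈0 = good g (g∈ , resp (V n) (trans (+-identityˡ (⊝ f)) gβ≈-f) (⊖∈ (V n) (0∈ (V n)) f∈))
    f≈0 : f ≈ 0#
    f≈0 = ·-integral w₁≉0 (begin
      w₁ · f                     ≈⟨ solve 4 (λ f g w₁ w₂ → w₁ :* f := (f :* w₁ :+ g :* w₂) :- g :* w₂) refl f g w₁ w₂ ⟩
      (f · w₁ ⊕ g · w₂) ⊖ g · w₂ ≈⟨ +-cong eq (-‿cong (*-congʳ g≈0)) ⟩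
      0# ⊖ 0# · w₂               ≈⟨ solve 1 (λ w → :0 :- :0 :* w := :0) refl w₂ ⟩
      0#                         ∎)

  Independent⇒≉0 : ∀ {w₁ w₂} → Independent w₁ w₂ → ¬ (w₁ ≈ 0#)
  Independent⇒≉0 {w₁} {w₂} ind w₁≈0 = 1≉0 (proj₁ (ind 1# 0# (1∈V k) (0∈ (V n))
    (trans (+-congʳ (*-congˡ w₁≈0)) (solve 1 (λ w → :1 :* :0 :+ :0 :* w := :0) refl w₂))))

  -- An element `g` of `U n β` yields the relation with coefficients `- g β` and `g`, both in `V n`.
  Independent⇒GoodPair : ∀ {w₁ w₂} → Independent w₁ w₂ → GoodPair w₁ w₂
  Independent⇒GoodPair {w₁} {w₂} ind = w₁≉0 , λ g (g∈ , gβ∈) → proj₂ (ind (0# ⊖ g · (w₂ · inv w₁)) g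
    (⊖∈ (V n) (0∈ (V n)) gβ∈) g∈
    (trans (solve 4 (λ g w₁ w₂ i → (:0 :- g :* (w₂ :* i)) :* w₁ :+ g :* w₂ := g :* w₂ :* (:1 :- i :* w₁)) refl g w₁ w₂ (inv w₁))
      (trans (*-congˡ (x≈y⇒x-y≈0 (sym (inv-inverseˡ w₁≉0)))) (zeroʳ _))))
    where
    w₁≉0 = Independent⇒≉0 ind

  module _ {w₁ w₂} (ind : Independent w₁ w₂) where

    private
      w₁≉0 : ¬ (w₁ ≈ 0#)
      w₁≉0 = Independent⇒≉0 ind

      quotient : Carrier → Carrier → Carrier
      quotient x g = (x ⊖ g · w₂) · inv w₁

      decompose : ∀ x g → x ≈ quotient x g · w₁ ⊕ g · w₂
      decompose x g = sym (trans
        (+-congʳ (trans (*-assoc _ _ _) (trans (*-congˡ (inv-inverseˡ w₁≉0)) (*-identityʳ _))))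
        (solve 2 (λ x y → x :- y :+ y := x) refl x (g · w₂)))

      -- In `x = f w₁ + g w₂` the choice of `g` forces `f`, so representations are indexed by `g`
      -- alone. For fixed `g` the map `x ↦ quotient x g` is a bijection of `L`, which makes the
      -- total easy to count.
      R? : ∀ x g → Dec (g ∈ V n × quotient x g ∈ V n)
      R? x g = member? (V n) g ×-dec member? (V n) (quotient x g)

    independent-≈ : ∀ {f g f′ g′} → f ∈ V n → g ∈ V n → f′ ∈ V n → g′ ∈ V n →
      f · w₁ ⊕ g · w₂ ≈ f′ · w₁ ⊕ g′ · w₂ → f ≈ f′ × g ≈ g′
    independent-≈ {f} {g} {f′} {g′} f∈ g∈ f′∈ g′∈ eq =
      let f≈ , g≈ = ind (f ⊖ f′) (g ⊖ g′) (⊖∈ (V n) f∈ f′∈) (⊖∈ (V n) g∈ g′∈)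
            (trans (solve 6 (λ f g f′ g′ w₁ w₂ → (f :- f′) :* w₁ :+ (g :- g′) :* w₂ :=
                (f :* w₁ :+ g :* w₂) :- (f′ :* w₁ :+ g′ :* w₂)) refl f g f′ g′ w₁ w₂)
              (x≈y⇒x-y≈0 eq))
      in x-y≈0⇒x≈y f≈ , x-y≈0⇒x≈y g≈

    -- V n × V n and L are equinumerous, so the injection (f , g) ↦ f w₁ + g w₂ is onto.
    sum-representations : sumL (λ x → sumL (λ g → [ R? x g ])) ≡ sumL (λ _ → 1)
    sum-representations = begin
      sumL (λ x → sumL (λ g → [ R? x g ]))             ≡⟨ ∑-comm (λ i j → [ R? (e i) (e j) ]) ⟩
      sumL (λ g → sumL (λ x → [ R? x g ]))             ≡⟨ sumL-cong inner ⟩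
      sumL (λ g → [ member? (V n) g ] * q ^ n)         ≡⟨ *-distribʳ-sum (q ^ n) (λ i → [ member? (V n) (e i) ]) ⟨
      # V n * q ^ n                                    ≡⟨ ≡.cong (_* q ^ n) (#-V n n≤2n) ⟩
      q ^ n * q ^ n                                    ≡⟨ N≡q^n*q^n ⟨
      N                                                ≡⟨ ℕ.*-identityʳ N ⟨
      N * 1                                            ≡⟨ sum-const N 1 ⟨
      sumL (λ _ → 1)                                   ∎
      where
      open ≡-Reasoning
      inner : ∀ g → sumL (λ x → [ R? x g ]) ≡ [ member? (V n) g ] * q ^ n
      inner g = begin
        sumL (λ x → [ R? x g ])
          ≡⟨ sumL-cong (λ x → []-× (member? (V n) g) (member? (V n) (quotient x g))) ⟩
        sumL (λ x → [ member? (V n) g ] * [ member? (V n) (quotient x g) ])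
          ≡⟨ *-distribˡ-sum [ member? (V n) g ] (λ i → [ member? (V n) (quotient (e i) g) ]) ⟨
        [ member? (V n) g ] * sumL (λ x → [ member? (V n) (quotient x g) ])
          ≡⟨ ≡.cong ([ member? (V n) g ] *_) (≡.trans
              (sumL-translate (λ x → [ member? (V n) (x · inv w₁) ]) (λ x≈y → indicator-cong (V n) (*-congʳ x≈y)) (g · w₂))
              (sumL-scale (λ x → [ member? (V n) x ]) (indicator-cong (V n)) (inv≉0 w₁≉0))) ⟩
        [ member? (V n) g ] * # V n
          ≡⟨ ≡.cong ([ member? (V n) g ] *_) (#-V n n≤2n) ⟩
        [ member? (V n) g ] * q ^ n ∎

    representation : ∀ x → ∃ λ f → ∃ λ g → f ∈ V n × g ∈ V n × x ≈ f · w₁ ⊕ g · w₂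
    representation x = let f , g , f∈ , g∈ , eq = enumerated (index x) in f , g , f∈ , g∈ , trans (sym (e-index x)) eq
      where
      at-most-one : ∀ i → sumL (λ g → [ R? (e i) g ]) ≤ 1
      at-most-one i = sum-≤1 (λ j → R? (e i) (e j)) (λ j j′ (g∈ , f∈) (g′∈ , f′∈) → e-injective j j′
        (proj₂ (independent-≈ f∈ g∈ f′∈ g′∈ (trans (sym (decompose (e i) (e j))) (decompose (e i) (e j′))))))
      exactly-one : ∀ i → sumL (λ g → [ R? (e i) g ]) ≡ 1
      exactly-one = sum-≤-≡⇒≗ _ _ at-most-one sum-representations
      enumerated : ∀ i → ∃ λ f → ∃ λ g → f ∈ V n × g ∈ V n × e i ≈ f · w₁ ⊕ g · w₂
      enumerated i with any? (λ j → R? (e i) (e j))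
      ... | yes (j , g∈ , f∈) = quotient (e i) (e j) , e j , f∈ , g∈ , decompose (e i) (e j)
      ... | no none = contradiction (≡.trans (≡.sym (exactly-one i)) (sum-none _ (λ j h → none (j , h)))) λ ()

  -- Power sums in α and coefficient vectors

  sumFin-cong : ∀ m {f g : Fin m → Carrier} → (∀ i → f i ≈ g i) → sumFin m f ≈ sumFin m g
  sumFin-cong zero h = refl
  sumFin-cong (suc m) h = +-cong (h zero) (sumFin-cong m (λ i → h (suc i)))

  sumFin-0 : ∀ m → sumFin m (λ _ → 0#) ≈ 0#
  sumFin-0 zero = refl
  sumFin-0 (suc m) = trans (+-identityˡ _) (sumFin-0 m)

  sumFin-distribˡ : ∀ m c (f : Fin m → Carrier) → sumFin m (λ i → c · f i) ≈ c · sumFin m f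
  sumFin-distribˡ zero c f = sym (zeroʳ c)
  sumFin-distribˡ (suc m) c f = trans (+-congˡ (sumFin-distribˡ m c (λ i → f (suc i)))) (sym (distribˡ c _ _))

  -- Definitionally the sum in `IsSplitting`. With entries in `K` it is also the polynomial in α
  -- with these coefficients, and `comb-linear` connects the two readings.
  comb : (m : ℕ) → (Fin m → Carrier) → Carrier
  comb m a = sumFin m (λ i → pow α (toℕ i) · a i)

  comb-cong : ∀ m {a b : Fin m → Carrier} → (∀ i → a i ≈ b i) → comb m a ≈ comb m b
  comb-cong m h = sumFin-cong m (λ i → *-congˡ (h i))

  comb-0 : ∀ m → comb m (λ _ → 0#) ≈ 0#
  comb-0 m = trans (sumFin-cong m (λ i → zeroʳ (pow α (toℕ i)))) (sumFin-0 m)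

  comb-suc : ∀ m a → comb (suc m) a ≈ a zero ⊕ α · comb m (λ i → a (suc i))
  comb-suc m a = +-cong (*-identityˡ (a zero))
    (trans (sumFin-cong m (λ i → *-assoc α _ _)) (sumFin-distribˡ m α (λ i → pow α (toℕ i) · a (suc i))))

  comb-linear : ∀ m a b u v → comb m (λ i → a i · u ⊕ b i · v) ≈ comb m a · u ⊕ comb m b · v
  comb-linear zero a b u v = solve 2 (λ u v → :0 := :0 :* u :+ :0 :* v) refl u v
  comb-linear (suc m) a b u v = begin
    comb (suc m) (λ i → a i · u ⊕ b i · v)                               ≈⟨ comb-suc m (λ i → a i · u ⊕ b i · v) ⟩
    a zero · u ⊕ b zero · v ⊕ α · comb m (λ i → a (suc i) · u ⊕ b (suc i) · v)
      ≈⟨ +-congˡ (*-congˡ (comb-linear m (λ i → a (suc i)) (λ i → b (suc i)) u v)) ⟩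
    a zero · u ⊕ b zero · v ⊕ α · (s · u ⊕ t · v)
      ≈⟨ solve 7 (λ α a b u v s t → a :* u :+ b :* v :+ α :* (s :* u :+ t :* v) := (a :+ α :* s) :* u :+ (b :+ α :* t) :* v)
           refl α (a zero) (b zero) u v s t ⟩
    (a zero ⊕ α · s) · u ⊕ (b zero ⊕ α · t) · v                          ≈⟨ +-cong (*-congʳ (comb-suc m a)) (*-congʳ (comb-suc m b)) ⟨
    comb (suc m) a · u ⊕ comb (suc m) b · v                              ∎
    where
    open import Relation.Binary.Reasoning.Setoid setoid
    s = comb m (λ i → a (suc i))
    t = comb m (λ i → b (suc i))

  constant∈V : ∀ m {c} → K c → c ∈ V (suc m)
  constant∈V m {c} Kc = resp (V (suc m)) (*-identityʳ c) (·∈ (V (suc m)) Kc (1∈V m))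

  comb∈V : ∀ m {a} → (∀ i → K (a i)) → comb m a ∈ V m
  comb∈V zero Ka = refl
  comb∈V (suc m) {a} Ka = resp (V (suc m)) (sym (comb-suc m a))
    (⊕∈ (V (suc m)) (constant∈V m (Ka zero)) (α·V m (comb∈V m (λ i → Ka (suc i)))))

  -- `V` grows at the top degree whereas `comb` unfolds at degree zero; this reconciles the two
  -- recursions.
  constant-term : ∀ m {x} → x ∈ V (suc m) → ∃ λ c → K c × ∃ λ y → y ∈ V m × x ≈ c ⊕ α · y
  constant-term zero {x} (c , Kc , h) = c , Kc , 0# , refl ,
    trans (x-y≈0⇒x≈y h) (solve 2 (λ c α → c :* :1 := c :+ α :* :0) refl c α)
  constant-term (suc m) {x} (c , Kc , h) with constant-term m h
  ... | c₀ , Kc₀ , y , y∈ , eq = c₀ , Kc₀ , y ⊕ c · pow α m ,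
    ⊕∈ (V (suc m)) (⊆Ext (pow α m) (V m) y∈) (·∈ (V (suc m)) Kc (v∈Ext (pow α m) (V m))) ,
    trans (solve 4 (λ x c α p → x := (x :- c :* (α :* p)) :+ c :* (α :* p)) refl x c α (pow α m))
      (trans (+-congʳ eq)
        (solve 5 (λ c₀ α y c p → c₀ :+ α :* y :+ c :* (α :* p) := c₀ :+ α :* (y :+ c :* p)) refl c₀ α y c (pow α m)))

  coefficients : ∀ m {x} → x ∈ V m → ∃ λ (a : Fin m → Carrier) → (∀ i → K (a i)) × x ≈ comb m a
  coefficients zero x≈0 = (λ ()) , (λ ()) , x≈0
  coefficients (suc m) x∈ with constant-term m x∈
  ... | c , Kc , y , y∈ , eq with coefficients m y∈
  ... | a , Ka , eq′ = b , Kb , trans eq (trans (+-congˡ (*-congˡ eq′)) (sym (comb-suc m b)))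
    where
    b : Fin (suc m) → Carrier
    b zero = c
    b (suc i) = a i
    Kb : ∀ i → K (b i)
    Kb zero = Kc
    Kb (suc i) = Ka i

  -- A constant lies in every nonzero `V`, so `α·-cancel-V` can lower the degree bound on `y` again
  -- and again until it reaches `V 0`.
  α·-constant⇒0 : ∀ m {y} → m < 2 * n → y ∈ V m → α · y ∈ V 1 → y ≈ 0#
  α·-constant⇒0 zero _ y≈0 _ = y≈0
  α·-constant⇒0 (suc m) m<d y∈ αy∈ = α·-constant⇒0 m (ℕ.<⇒≤ m<d)
    (α·-cancel-V m m<d y∈ (V-mono {1} {suc m} (s≤s z≤n) αy∈)) αy∈

  -- In `c + α y = 0` the product `α y` is constant, so `y` vanishes, and then `c` does; the
  -- induction continues with `y`.
  comb≈0⇒≈0 : ∀ m {a} → m ≤ 2 * n → (∀ i → K (a i)) → comb m a ≈ 0# → ∀ i → a i ≈ 0#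
  comb≈0⇒≈0 (suc m) {a} m<d Ka eq = λ where
      zero → trans (solve 3 (λ c α y → c := (c :+ α :* y) :- α :* y) refl (a zero) α y)
        (trans (+-cong c+αy≈0 (-‿cong (*-congˡ y≈0))) (solve 1 (λ α → :0 :- α :* :0 := :0) refl α))
      (suc i) → comb≈0⇒≈0 m (ℕ.<⇒≤ m<d) (λ i → Ka (suc i)) y≈0 i
    where
    y = comb m (λ i → a (suc i))
    c+αy≈0 : a zero ⊕ α · y ≈ 0#
    c+αy≈0 = trans (sym (comb-suc m a)) eq
    y≈0 : y ≈ 0#
    y≈0 = α·-constant⇒0 m m<d (comb∈V m (λ i → Ka (suc i)))
      (resp (V 1) (solve 3 (λ c α y → (:0 :- c) :+ (c :+ α :* y) := α :* y) refl (a zero) α y)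
        (⊕∈ (V 1) (⊖∈ (V 1) (0∈ (V 1)) (constant∈V 0 (Ka zero))) (resp (V 1) (sym c+αy≈0) (0∈ (V 1)))))

  -- Planes over `K` and their ordered bases

  Span : Carrier → Carrier → Subspace
  Span w₁ w₂ = Ext w₂ (Ext w₁ Zero)

  w₁∈Span : ∀ w₁ w₂ → w₁ ∈ Span w₁ w₂
  w₁∈Span w₁ w₂ = ⊆Ext w₂ (Ext w₁ Zero) (v∈Ext w₁ Zero)

  w₂∈Span : ∀ w₁ w₂ → w₂ ∈ Span w₁ w₂
  w₂∈Span w₁ w₂ = v∈Ext w₂ (Ext w₁ Zero)

  Span-coefficients : ∀ {w₁ w₂ x} → x ∈ Span w₁ w₂ → Σ Carrier λ a → Σ Carrier λ b → K a × K b × x ≈ a · w₁ ⊕ b · w₂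
  Span-coefficients {w₁} {w₂} {x} (b , Kb , a , Ka , h) = a , b , Ka , Kb ,
    x-y≈0⇒x≈y (trans (solve 3 (λ x u v → x :- (u :+ v) := x :- v :- u) refl x (a · w₁) (b · w₂)) h)

  Span-⊆ : ∀ {w₁ w₂ W} → IsSubspace K W → W w₁ → W w₂ → ∀ {x} → x ∈ Span w₁ w₂ → W x
  Span-⊆ (W-resp , W0 , W⊕ , W·) Ww₁ Ww₂ x∈ =
    let a , b , Ka , Kb , eq = Span-coefficients x∈ in W-resp (sym eq) (W⊕ (W· Ka Ww₁) (W· Kb Ww₂))

  combination∈Span : ∀ w₁ w₂ {a b} → K a → K b → a · w₁ ⊕ b · w₂ ∈ Span w₁ w₂
  combination∈Span w₁ w₂ Ka Kb = ⊕∈ (Span w₁ w₂)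
    (·∈ (Span w₁ w₂) Ka (w₁∈Span w₁ w₂)) (·∈ (Span w₁ w₂) Kb (w₂∈Span w₁ w₂))

  K-Independent : Carrier → Carrier → Set
  K-Independent w₁ w₂ = ∀ {a b} → K a → K b → a · w₁ ⊕ b · w₂ ≈ 0# → a ≈ 0# × b ≈ 0#

  Independent⇒K-Independent : ∀ {w₁ w₂} → Independent w₁ w₂ → K-Independent w₁ w₂
  Independent⇒K-Independent ind Ka Kb = ind _ _ (constant∈V k Ka) (constant∈V k Kb)

  -- Independence in the form that can be counted: a nonzero vector, then one off its line.
  Frame : Carrier → Carrier → Set
  Frame w₁ w₂ = ¬ (w₁ ≈ 0#) × w₂ ∉ Ext w₁ Zero

  K-Independent⇒Frame : ∀ {w₁ w₂} → K-Independent w₁ w₂ → Frame w₁ w₂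
  K-Independent⇒Frame {w₁} {w₂} ind =
    (λ w₁≈0 → 1≉0 (proj₁ (ind K1 K0
      (trans (+-congʳ (*-congˡ w₁≈0)) (solve 1 (λ w → :1 :* :0 :+ :0 :* w := :0) refl w₂))))) ,
    λ (c , Kc , h) → 1≉0 (proj₂ (ind (K⊝ Kc) K1
      (trans (solve 3 (λ c w₁ w₂ → (:- c) :* w₁ :+ :1 :* w₂ := w₂ :- c :* w₁) refl c w₁ w₂) h)))

  Frame⇒K-Independent : ∀ {w₁ w₂} → Frame w₁ w₂ → K-Independent w₁ w₂
  Frame⇒K-Independent {w₁} {w₂} (w₁≉0 , w₂∉) {a} {b} Ka Kb eq with b ≈? 0#
  ... | yes b≈0 = ·-integral w₁≉0
      (trans (solve 4 (λ a b w₁ w₂ → w₁ :* a := (a :* w₁ :+ b :* w₂) :- b :* w₂) refl a b w₁ w₂)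
        (trans (+-cong eq (-‿cong (*-congʳ b≈0))) (solve 1 (λ w → :0 :- :0 :* w := :0) refl w₂))) , b≈0
  ... | no b≉0 = contradiction (cancel-scalar (Ext w₁ Zero) Kb b≉0
      (⊝ a , K⊝ Ka , trans (solve 4 (λ a b w₁ w₂ → b :* w₂ :- (:- a) :* w₁ := a :* w₁ :+ b :* w₂) refl a b w₁ w₂) eq)) w₂∉

  #-line : ∀ {w} → ¬ (w ≈ 0#) → # Ext w Zero ≡ q
  #-line {w} w≉0 = ≡.trans (#-Ext w Zero w≉0) (≡.trans (≡.cong (q *_) sumL-zero) (ℕ.*-identityʳ q))

  #-Span : ∀ {w₁ w₂} → Frame w₁ w₂ → # Span w₁ w₂ ≡ q * q
  #-Span {w₁} {w₂} (w₁≉0 , w₂∉) = ≡.trans (#-Ext w₂ (Ext w₁ Zero) w₂∉) (≡.cong (q *_) (#-line w₁≉0))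

  -- Expanding `f` and `g` in powers of α regroups `f w₁ + g w₂` as a sum of `α ^ i` times vectors
  -- of the plane. Existence is thus `representation`, and uniqueness follows from `Independent`
  -- together with the independence of the powers of α.
  Independent⇒IsSplitting : ∀ {w₁ w₂} → Independent w₁ w₂ → IsSplitting α n (member (Span w₁ w₂))
  Independent⇒IsSplitting {w₁} {w₂} ind = exists , unique
    where
    exists : ∀ x → Σ (Fin n → Carrier) λ w → (∀ i → w i ∈ Span w₁ w₂) × x ≈ comb n w
    exists x with representation ind x
    ... | f , g , f∈ , g∈ , eq with coefficients n f∈ | coefficients n g∈
    ... | a , Ka , f≈ | b , Kb , g≈ = (λ i → a i · w₁ ⊕ b i · w₂) , (λ i → combination∈Span w₁ w₂ (Ka i) (Kb i)) ,
      trans eq (trans (+-cong (*-congʳ f≈) (*-congʳ g≈)) (sym (comb-linear n a b w₁ w₂)))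
    unique : ∀ w w′ → (∀ i → w i ∈ Span w₁ w₂) → (∀ i → w′ i ∈ Span w₁ w₂) → comb n w ≈ comb n w′ → ∀ i → w i ≈ w′ i
    unique w w′ w∈ w′∈ eq i = x-y≈0⇒x≈y (trans (difference i)
        (trans (+-cong (*-congʳ (a≈0 i)) (*-congʳ (b≈0 i))) (solve 2 (λ u v → :0 :* u :+ :0 :* v := :0) refl w₁ w₂)))
      where
      v : Fin n → Carrier
      v i = w i ⊖ w′ i
      v∈ : ∀ i → v i ∈ Span w₁ w₂
      v∈ i = ⊖∈ (Span w₁ w₂) (w∈ i) (w′∈ i)
      a b : Fin n → Carrier
      a i = proj₁ (Span-coefficients (v∈ i))
      b i = proj₁ (proj₂ (Span-coefficients (v∈ i)))
      Ka : ∀ i → K (a i)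
      Ka i = proj₁ (proj₂ (proj₂ (Span-coefficients (v∈ i))))
      Kb : ∀ i → K (b i)
      Kb i = proj₁ (proj₂ (proj₂ (proj₂ (Span-coefficients (v∈ i)))))
      difference : ∀ i → v i ≈ a i · w₁ ⊕ b i · w₂
      difference i = proj₂ (proj₂ (proj₂ (proj₂ (Span-coefficients (v∈ i)))))
      comb-v≈0 : comb n v ≈ 0#
      comb-v≈0 = trans
        -- The difference is written as `x · 1 + y · (- 1)` to fall under `comb-linear`.
        (comb-cong n (λ i → solve 2 (λ x y → x :- y := x :* :1 :+ y :* (:- :1)) refl (w i) (w′ i)))
        (trans (comb-linear n w w′ 1# (⊝ 1#))
          (trans (solve 2 (λ x y → x :* :1 :+ y :* (:- :1) := x :- y) refl (comb n w) (comb n w′)) (x≈y⇒x-y≈0 eq)))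
      both≈0 : comb n a ≈ 0# × comb n b ≈ 0#
      both≈0 = ind (comb n a) (comb n b) (comb∈V n Ka) (comb∈V n Kb)
        (trans (sym (comb-linear n a b w₁ w₂)) (trans (comb-cong n (λ i → sym (difference i))) comb-v≈0))
      a≈0 : ∀ i → a i ≈ 0#
      a≈0 = comb≈0⇒≈0 n n≤2n Ka (proj₁ both≈0)
      b≈0 : ∀ i → b i ≈ 0#
      b≈0 = comb≈0⇒≈0 n n≤2n Kb (proj₂ both≈0)

  -- Uniqueness, applied to the family `a i · w₁ ⊕ b i · w₂` and the zero family, kills all
  -- coefficients of `f` and `g` at once. Any basis of `W` will do, so being good depends on the
  -- plane alone.
  IsSplitting⇒Independent : ∀ {W w₁ w₂} → IsSubspace K W → W w₁ → W w₂ → K-Independent w₁ w₂ →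
    IsSplitting α n W → Independent w₁ w₂
  IsSplitting⇒Independent {W} {w₁} {w₂} (W-resp , W0 , W⊕ , W·) Ww₁ Ww₂ ind (_ , unique) f g f∈ g∈ eq
    with coefficients n f∈ | coefficients n g∈
  ... | a , Ka , f≈ | b , Kb , g≈ =
      trans f≈ (trans (comb-cong n (λ i → proj₁ (both≈0 i))) (comb-0 n)) ,
      trans g≈ (trans (comb-cong n (λ i → proj₂ (both≈0 i))) (comb-0 n))
    where
    both≈0 : ∀ i → a i ≈ 0# × b i ≈ 0#
    both≈0 i = ind (Ka i) (Kb i) (unique (λ i → a i · w₁ ⊕ b i · w₂) (λ _ → 0#)
      (λ i → W⊕ (W· (Ka i) Ww₁) (W· (Kb i) Ww₂)) (λ _ → W0)
      (trans (comb-linear n a b w₁ w₂) (trans (sym (+-cong (*-congʳ f≈) (*-congʳ g≈))) (trans eq (sym (comb-0 n))))) i)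

  GoodPair⇒Is2DimSplitting : ∀ {w₁ w₂} → GoodPair w₁ w₂ → Is2DimSplitting K α n (member (Span w₁ w₂))
  GoodPair⇒Is2DimSplitting {w₁} {w₂} good = isSubspace (Span w₁ w₂) ,
      (w₁ , w₂ , w₁∈Span w₁ w₂ , w₂∈Span w₁ w₂ , Independent⇒K-Independent ind , Span-coefficients) ,
      Independent⇒IsSplitting ind
    where
    ind : Independent w₁ w₂
    ind = GoodPair⇒Independent good

  basis⇒GoodPair : ∀ {W w₁ w₂} → Is2DimSplitting K α n W → W w₁ → W w₂ → K-Independent w₁ w₂ → GoodPair w₁ w₂
  basis⇒GoodPair {W} (sub , _ , split) Ww₁ Ww₂ ind =
    Independent⇒GoodPair (IsSplitting⇒Independent {W} sub Ww₁ Ww₂ ind split)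

  -- Good pairs grouped by their span

  SameSpan : (v w : Carrier × Carrier) → Set
  SameSpan (v₁ , v₂) (w₁ , w₂) = SameSet (member (Span v₁ v₂)) (member (Span w₁ w₂))

  SameSpan? : ∀ v w → Dec (SameSpan v w)
  SameSpan? (v₁ , v₂) (w₁ , w₂) = ⊆? (Span v₁ v₂) (Span w₁ w₂) ×-dec ⊆? (Span w₁ w₂) (Span v₁ v₂)
    where
    ⊆? : ∀ W X → Dec (W ⊆ X)
    ⊆? W X = map′ (λ h {x} → h x) (λ h x → h {x}) (all-dec (λ x → member? W x →-dec member? X x)
      (λ x≈y h y∈ → resp X x≈y (h (resp W (sym x≈y) y∈))))

  module _ {w₁ w₂} (good : GoodPair w₁ w₂) where

    private
      W : Subspace
      W = Span w₁ w₂

    GoodPair⇒Frame : Frame w₁ w₂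
    GoodPair⇒Frame = K-Independent⇒Frame (Independent⇒K-Independent (GoodPair⇒Independent good))

    -- A frame inside `W` spans `q * q` elements, as many as `W` has, so it spans `W`; it is good
    -- because `W` is splitting.
    basis⇒class : ∀ {v₁ v₂} → v₁ ∈ W → v₂ ∈ W → Frame v₁ v₂ → GoodPair v₁ v₂ × SameSpan (w₁ , w₂) (v₁ , v₂)
    basis⇒class {v₁} {v₂} v₁∈ v₂∈ frame =
      basis⇒GoodPair {member W} (GoodPair⇒Is2DimSplitting good) v₁∈ v₂∈ (Frame⇒K-Independent frame) ,
      ⊆∧#≡⇒⊇ (Span v₁ v₂) W Span⊆W (≡.trans (#-Span frame) (≡.sym (#-Span GoodPair⇒Frame))) ,
      Span⊆W
      where
      Span⊆W : Span v₁ v₂ ⊆ W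
      Span⊆W = Span-⊆ (isSubspace W) v₁∈ v₂∈

  -- By `basis⇒class` the class consists of all frames lying in `W`: a nonzero `v₁`, then `v₂` off
  -- the line of `v₁`.
  class-size : ∀ {w₁ w₂} → GoodPair w₁ w₂ →
    sumL (λ v₁ → sumL (λ v₂ → [ GoodPair? v₁ v₂ ×-dec SameSpan? (w₁ , w₂) (v₁ , v₂) ])) ≡ (q * q ∸ 1) * (q * q ∸ q)
  class-size {w₁} {w₂} good = begin
    sumL (λ v₁ → sumL (λ v₂ → [ GoodPair? v₁ v₂ ×-dec SameSpan? (w₁ , w₂) (v₁ , v₂) ]))
      ≡⟨ sumL-cong inner ⟩
    sumL (λ v₁ → [ member? W v₁ ×-dec ¬? (v₁ ≈? 0#) ] * (q * q ∸ q))
      ≡⟨ *-distribʳ-sum (q * q ∸ q) (λ i → [ member? W (e i) ×-dec ¬? (e i ≈? 0#) ]) ⟨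
    sumL (λ v₁ → [ member? W v₁ ×-dec ¬? (v₁ ≈? 0#) ]) * (q * q ∸ q)
      ≡⟨ ≡.cong (_* (q * q ∸ q)) (≡.trans (sumL-minus (member? W) (_≈? 0#) (λ x≈0 → resp W (sym x≈0) (0∈ W)))
          (≡.cong₂ _∸_ #W sumL-zero)) ⟩
    (q * q ∸ 1) * (q * q ∸ q) ∎
    where
    open ≡-Reasoning
    W = Span w₁ w₂
    #W : # W ≡ q * q
    #W = #-Span (GoodPair⇒Frame good)
    inner : ∀ v₁ → sumL (λ v₂ → [ GoodPair? v₁ v₂ ×-dec SameSpan? (w₁ , w₂) (v₁ , v₂) ])
      ≡ [ member? W v₁ ×-dec ¬? (v₁ ≈? 0#) ] * (q * q ∸ q)
    inner v₁ = begin
      sumL (λ v₂ → [ GoodPair? v₁ v₂ ×-dec SameSpan? (w₁ , w₂) (v₁ , v₂) ])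
        ≡⟨ sumL-cong (λ v₂ → []-cong (GoodPair? v₁ v₂ ×-dec SameSpan? (w₁ , w₂) (v₁ , v₂))
             (v₁? ×-dec v₂? v₂)
             (λ (good′ , _ , Span⊆W) → let v₁≉0 , v₂∉ = GoodPair⇒Frame good′ in
                (Span⊆W (w₁∈Span v₁ v₂) , v₁≉0) , Span⊆W (w₂∈Span v₁ v₂) , v₂∉)
             (λ ((v₁∈ , v₁≉0) , v₂∈ , v₂∉) → basis⇒class good v₁∈ v₂∈ (v₁≉0 , v₂∉))) ⟩
      sumL (λ v₂ → [ v₁? ×-dec v₂? v₂ ])            ≡⟨ sumL-cong (λ v₂ → []-× v₁? (v₂? v₂)) ⟩
      sumL (λ v₂ → [ v₁? ] * [ v₂? v₂ ])            ≡⟨ *-distribˡ-sum [ v₁? ] (λ i → [ v₂? (e i) ]) ⟨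
      [ v₁? ] * sumL (λ v₂ → [ v₂? v₂ ])            ≡⟨ complement v₁? ⟩
      [ v₁? ] * (q * q ∸ q)                         ∎
      where
      v₁? : Dec (v₁ ∈ W × ¬ (v₁ ≈ 0#))
      v₁? = member? W v₁ ×-dec ¬? (v₁ ≈? 0#)
      v₂? : ∀ v₂ → Dec (v₂ ∈ W × v₂ ∉ Ext v₁ Zero)
      v₂? v₂ = member? W v₂ ×-dec ¬? (member? (Ext v₁ Zero) v₂)
      complement : (d : Dec (v₁ ∈ W × ¬ (v₁ ≈ 0#))) → [ d ] * sumL (λ v₂ → [ v₂? v₂ ]) ≡ [ d ] * (q * q ∸ q)
      complement (no _) = ≡.refl
      complement (yes (v₁∈ , v₁≉0)) = ≡.cong (1 *_) (≡.trans
        (sumL-minus (member? W) (member? (Ext v₁ Zero))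
          (Ext-⊆ v₁ Zero W (λ x≈0 → resp W (sym x≈0) (0∈ W)) v₁∈))
        (≡.cong₂ _∸_ #W (#-line v₁≉0)))

  -- Enumeration of the splitting planes and the final count

  pair : Fin (N * N) → Carrier × Carrier
  pair p = let i , j = remQuot {N} N p in e i , e j

  Good-at : Fin (N * N) → Set
  Good-at p = let w₁ , w₂ = pair p in GoodPair w₁ w₂

  Good-at? : ∀ p → Dec (Good-at p)
  Good-at? p = let w₁ , w₂ = pair p in GoodPair? w₁ w₂

  sum-pairs : (F : Carrier × Carrier → ℕ) → sum (λ p → F (pair p)) ≡ sumL (λ x → sumL (λ y → F (x , y)))
  sum-pairs F = sum-remQuot N N (λ (i , j) → F (e i , e j))

  spans : ∃ λ S → CountedBy Good-at (λ p p′ → SameSpan (pair p) (pair p′)) S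
  spans = representatives Good-at? (λ p p′ → SameSpan? (pair p) (pair p′))
    ((λ h → h) , (λ h → h)) (λ (f , g) → g , f)

  S : ℕ
  S = proj₁ spans

  splitting-subspaces : CountedBy (Is2DimSplitting K α n) SameSet S
  splitting-subspaces = let f , good , injective , surjective = proj₂ spans in
    (λ s → let w₁ , w₂ = pair (f s) in member (Span w₁ w₂)) ,
    (λ s → GoodPair⇒Is2DimSplitting (good s)) ,
    injective ,
    λ W split → let p , good-p , same = locate W split
                    s , same′ = surjective p good-p
                in s , (λ h → proj₁ same (proj₁ same′ h)) , (λ h → proj₂ same′ (proj₂ same h))
    where
    -- The basis supplied with `W` is replaced by its `≈`-equal enumerated copy, since an index
    -- always stands for enumerated elements.
    locate : ∀ W → Is2DimSplitting K α n W →
      ∃ λ p → Good-at p × SameSet (let w₁ , w₂ = pair p in member (Span w₁ w₂)) W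
    locate W split@(sub@(W-resp , _) , (w₁ , w₂ , Ww₁ , Ww₂ , ind , spanning) , _) =
      combine (index w₁) (index w₂) , at (≡.cong (λ (i , j) → e i , e j) (remQuot-combine (index w₁) (index w₂)))
      where
      v₁ = e (index w₁)
      v₂ = e (index w₂)
      Wv₁ : W v₁
      Wv₁ = W-resp (sym (e-index w₁)) Ww₁
      Wv₂ : W v₂
      Wv₂ = W-resp (sym (e-index w₂)) Ww₂
      replace : ∀ {a b} → a · v₁ ⊕ b · v₂ ≈ a · w₁ ⊕ b · w₂
      replace = +-cong (*-congˡ (e-index w₁)) (*-congˡ (e-index w₂))
      -- `remQuot` undoes `combine` only up to a propositional equality, so the claim is generalised
      -- to `u` and the equality is matched.
      at : ∀ {u} → u ≡ (v₁ , v₂) →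
        GoodPair (proj₁ u) (proj₂ u) × SameSet (member (Span (proj₁ u) (proj₂ u))) W
      at ≡.refl =
        basis⇒GoodPair {W} split Wv₁ Wv₂ (λ Ka Kb h → ind Ka Kb (trans (sym replace) h)) ,
        Span-⊆ sub Wv₁ Wv₂ ,
        λ x∈ → let a , b , Ka , Kb , x≈ = spanning x∈ in
          resp (Span v₁ v₂) (trans replace (sym x≈)) (combination∈Span v₁ v₂ Ka Kb)

  S-equation : S * ((q * q ∸ 1) * (q * q ∸ q)) ≡ (N ∸ 1) * #Good
  S-equation = ≡.trans
    (classes-count Good-at? (λ p p′ → SameSpan? (pair p) (pair p′))
      (λ (f , g) → g , f) (λ (f , g) (f′ , g′) → (λ h → f′ (f h)) , (λ h → g (g′ h)))
      (proj₂ spans)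
      (λ p good → ≡.trans (sum-pairs (λ (v₁ , v₂) → [ GoodPair? v₁ v₂ ×-dec SameSpan? (pair p) (v₁ , v₂) ])) (class-size good)))
    (≡.trans (sum-pairs (λ (w₁ , w₂) → [ GoodPair? w₁ w₂ ])) #GoodPair)

  S-value : S * (q ^ 2 ∸ 1) ≡ (N ∸ 1) * q ^ (2 * k)
  S-value = ℕ.*-cancelʳ-≡ _ _ (r * q) {{ℕ.m*n≢0 r q {{ℕ.>-nonZero 0<r}}}} (begin
    S * (q ^ 2 ∸ 1) * (r * q)             ≡⟨ ≡.cong (λ m → S * (m ∸ 1) * (r * q)) (≡.cong (q *_) (ℕ.*-identityʳ q)) ⟩
    -- As `q` is `suc r`, `q * q` computes to `q + r * q`; this is where the cancelled factor
    -- `r * q` comes from.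
    S * (q * q ∸ 1) * (r * q)             ≡⟨ ≡.cong (S * (q * q ∸ 1) *_) (ℕ.m+n∸m≡n q (r * q)) ⟨
    S * (q * q ∸ 1) * (q * q ∸ q)         ≡⟨ ℕ.*-assoc S _ _ ⟩
    S * ((q * q ∸ 1) * (q * q ∸ q))       ≡⟨ S-equation ⟩
    (N ∸ 1) * #Good                       ≡⟨ ≡.cong ((N ∸ 1) *_) #Good-value ⟩
    (N ∸ 1) * (r * (q * (q ^ k * q ^ k))) ≡⟨ regroup (N ∸ 1) r q (q ^ k * q ^ k) ⟩
    (N ∸ 1) * (q ^ k * q ^ k) * (r * q)   ≡⟨ ≡.cong (λ m → (N ∸ 1) * m * (r * q)) (ℕ.^-distribˡ-+-* q k k) ⟨
    (N ∸ 1) * q ^ (k + k) * (r * q)       ≡⟨ ≡.cong (λ m → (N ∸ 1) * q ^ (k + m) * (r * q)) (ℕ.+-identityʳ k) ⟨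
    (N ∸ 1) * q ^ (2 * k) * (r * q)       ∎)
    where
    open ≡-Reasoning
    regroup : ∀ a r q y → a * (r * (q * y)) ≡ a * y * (r * q)
    regroup = solve-∀

IsPrimePower⇒1< : ∀ {q} → IsPrimePower q → 1 < q
IsPrimePower⇒1< (p , k , p-prime , ≡.refl) =
  ℕ.^-monoʳ-< p (ℕ.nonTrivial⇒n>1 p {{prime⇒nonTrivial p-prime}}) {0} {suc k} (s≤s z≤n)

open FieldTheory

theorem3p4 : (q n : ℕ) → IsPrimePower q → 1 ≤ n →
    (L : CommutativeRing 0ℓ 0ℓ) → IsField L →
    (K : Pred (CommutativeRing.Carrier L) 0ℓ) → IsSubfield L K →
    CountedBy K (CommutativeRing._≈_ L) q →
    CountedBy (λ (_ : CommutativeRing.Carrier L) → ⊤) (CommutativeRing._≈_ L) (q ^ (2 * n)) →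
    (α : CommutativeRing.Carrier L) → Generates L K α →
    Σ ℕ λ S → CountedBy (Is2DimSplitting L K α n) (SameSet L) S ×
    S * (q ^ 2 ∸ 1) ≡ (q ^ (2 * n) ∸ 1) * q ^ (2 * (n ∸ 1))
theorem3p4 zero _ q-prime-power = contradiction (IsPrimePower⇒1< q-prime-power) λ ()
theorem3p4 (suc r) (suc k) q-prime-power _ L L-field K K-subfield K-count L-count α generates =
  S , splitting-subspaces , S-value
  where
  open SplittingSubspaces L L-field K K-subfield r k (ℕ.s<s⁻¹ (IsPrimePower⇒1< q-prime-power)) K-count L-count α generates
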